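{- Let $n\ge1$. The reduced turning number is a lumping of $S_n$: the sums $\sum_\sigma\sigma$ over all $\sigma\in S_n$ with a given reduced turning number form a basis of a subalgebra of the group algebra $\mathbf{Q}[S_n]$ (the reduced turning algebra), and this subalgebra is commutative.
   Context: $S_n$ is the symmetric group on $\{1,\dots,n\}$, with permutations composed left to right: $(\sigma\tau)(i)=\tau(\sigma(i))$. The reduced turning number of $\sigma\in S_n$ is the number of $i$ with $1<i<n$ such that $\sigma(i)-\sigma(i-1)$ and $\sigma(i+1)-\sigma(i)$ have opposite signs (i.e. the number of interior local maxima and minima of the piecewise linear graph of $\sigma$; no turning point is recognized at $1$ or at $n$). In particular both the identity and the order-reversing permutation have reduced turning number $0$. "Subalgebra" means a linear subspace closed under multiplication; it is not required to contain the identity element of $S_n$. -}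

module Defs where

open import Data.Bool.Base using (if_then_else_)
open import Data.Fin.Base using (Fin; zero; suc; toℕ; inject₁; punchIn)
open import Data.Fin.Patterns using (0F)
open import Data.Fin.Permutation as Perm
  using (Permutation′; _⟨$⟩ʳ_; _∘ₚ_; flip; insert; remove; insert-remove; insert-punchIn)
open import Data.Fin.Properties as Fin using (all?; punchIn-injective)
import Data.Integer.Base as ℤ
import Data.Integer.Properties as ℤ
open import Data.List.Base
  using (List; []; _∷_; map; foldr; filter; length; allFin; cartesianProductWith)
open import Data.List.Membership.Propositional.Properties using (∈-allFin)
open import Data.List.Properties using (map-cong)
import Data.List.Relation.Unary.AllPairs as AllPairs
open import Data.List.Relation.Unary.All using (All)
open import Data.List.Relation.Unary.Any using (here)
open import Data.List.Relation.Unary.Enumerates.Setoid using (IsEnumeration)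
open import Data.List.Relation.Unary.Unique.Propositional using (Unique)
open import Data.List.Relation.Unary.Unique.Propositional.Properties using (allFin⁺)
import Data.List.Relation.Unary.Unique.Setoid as UniqueSetoid
import Data.List.Relation.Unary.Unique.Setoid.Properties as UniqueSetoid
import Data.List.Membership.Setoid.Properties as MembershipSetoid
open import Data.Nat.Base using (ℕ; zero; suc)
import Data.Nat.Properties as ℕ
open import Data.Product.Base using (∃; _×_; _,_)
open import Data.Rational.Base as ℚ using (ℚ; 0ℚ; 1ℚ)
open import Data.Sum.Base using (_⊎_)
open import Function.Bundles using (Func; mk⇔)
open import Level using (0ℓ)
open import Relation.Binary.Bundles using (Setoid)
open import Relation.Binary.PropositionalEquality
  using (_≡_; refl; sym; trans; cong; cong₂) renaming (setoid to ≡-setoid)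
open import Relation.Nullary.Decidable using (Dec; does; does-⇔; _×-dec_; _⊎-dec_)
open import Relation.Unary using (Pred; _∈_)

private
  variable
    n : ℕ

-- Data.Fin.Permutation has no function extensionality: a permutation also
-- carries its inverse and proofs, so permutations are compared pointwise.
S : ℕ → Setoid 0ℓ 0ℓ
S n = record
  { Carrier       = Permutation′ n
  ; _≈_           = Perm._≈_
  ; isEquivalence = record
    { refl  = λ _ → refl
    ; sym   = λ p i → sym (p i)
    ; trans = λ p q i → trans (p i) (q i)
    }
  }

_≈ₚ?_ : (σ τ : Permutation′ n) → Dec (σ Perm.≈ τ)
σ ≈ₚ? τ = all? λ i → (σ ⟨$⟩ʳ i) Fin.≟ (τ ⟨$⟩ʳ i)

permutations : ∀ n → List (Permutation′ n)
permutations zero    = Perm.id ∷ []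
permutations (suc n) =
  cartesianProductWith (insert 0F) (allFin (suc n)) (permutations n)

private
  insert-cong : ∀ {i j : Fin (suc n)} {σ τ : Permutation′ n} →
                i ≡ j → σ Perm.≈ τ → insert 0F i σ Perm.≈ insert 0F j τ
  insert-cong         refl p zero    = refl
  insert-cong {i = i} refl p (suc k) = cong (punchIn i) (p k)

  insert-injective : ∀ {i j : Fin (suc n)} {σ τ : Permutation′ n} →
                     insert 0F i σ Perm.≈ insert 0F j τ → i ≡ j × σ Perm.≈ τ
  insert-injective {i = i} {σ = σ} {τ} p with refl ← p zero =
    refl , λ k → punchIn-injective i _ _ (p (suc k))

permutations-complete : ∀ n → IsEnumeration (S n) (permutations n)
permutations-complete zero    σ = here λ ()
permutations-complete (suc n) σ =
  MembershipSetoid.∈-resp-≈ (S (suc n)) {permutations (suc n)}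
    {insert 0F (σ ⟨$⟩ʳ 0F) (remove 0F σ)} {σ} (insert-remove 0F σ)
    (MembershipSetoid.∈-cartesianProductWith⁺
      (≡-setoid (Fin (suc n))) (S n) (S (suc n)) insert-cong
      (∈-allFin (σ ⟨$⟩ʳ 0F)) (permutations-complete n (remove 0F σ)))

permutations-unique : ∀ n → UniqueSetoid.Unique (S n) (permutations n)
permutations-unique zero    = All.[] AllPairs.∷ AllPairs.[]
permutations-unique (suc n) =
  UniqueSetoid.cartesianProductWith⁺
    (≡-setoid (Fin (suc n))) (S n) (S (suc n)) (insert 0F) insert-injective
    (allFin⁺ (suc n)) (permutations-unique n)

-- An element of ℚ[Sₙ] is the function assigning to each permutation its
-- coefficient.
ℚ[S_] : ℕ → Set
ℚ[S n ] = Func (S n) (≡-setoid ℚ)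

open Func public using () renaming (to to coeff; cong to coeff-cong)

infix  4 _≈_
infixl 6 _+_
infixl 7 _*_
infixr 7 _•_

_≈_ : ℚ[S n ] → ℚ[S n ] → Set
a ≈ b = ∀ σ → coeff a σ ≡ coeff b σ

0# : ℚ[S n ]
0# = record { to = λ _ → 0ℚ ; cong = λ _ → refl }

_+_ : ℚ[S n ] → ℚ[S n ] → ℚ[S n ]
a + b = record
  { to   = λ σ → coeff a σ ℚ.+ coeff b σ
  ; cong = λ p → cong₂ ℚ._+_ (coeff-cong a p) (coeff-cong b p)
  }

_•_ : ℚ → ℚ[S n ] → ℚ[S n ]
q • a = record
  { to   = λ σ → q ℚ.* coeff a σ
  ; cong = λ p → cong (q ℚ.*_) (coeff-cong a p)
  }

sumℚ : List ℚ → ℚ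
sumℚ = foldr ℚ._+_ 0ℚ

-- The coefficient of π in (Σ aσ σ)(Σ bτ τ) is the sum of aσ bτ over the pairs
-- with στ = π, i.e. τ = σ⁻¹π.  The product of permutations is _∘ₚ_, which
-- composes left to right: (σ ∘ₚ τ) ⟨$⟩ʳ i = τ ⟨$⟩ʳ (σ ⟨$⟩ʳ i).
_*_ : ℚ[S n ] → ℚ[S n ] → ℚ[S n ]
_*_ {n} a b = record
  { to   = λ π → sumℚ (map (λ σ → coeff a σ ℚ.* coeff b (flip σ ∘ₚ π)) (permutations n))
  ; cong = λ p → cong sumℚ (map-cong
      (λ σ → cong (coeff a σ ℚ.*_) (coeff-cong b λ i → p (flip σ ⟨$⟩ʳ i)))
      (permutations n))
  }

⟦_⟧ : Permutation′ n → ℚ[S n ]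
⟦ σ ⟧ = record
  { to   = λ π → if does (σ ≈ₚ? π) then 1ℚ else 0ℚ
  ; cong = λ {π} {ρ} p → cong (if_then 1ℚ else 0ℚ)
      (does-⇔ (mk⇔ (λ q i → trans (q i) (p i)) (λ q i → trans (q i) (sym (p i))))
              (σ ≈ₚ? π) (σ ≈ₚ? ρ))
  }

sum : List (ℚ[S n ]) → ℚ[S n ]
sum = foldr _+_ 0#

record IsSubalgebra (A : Pred (ℚ[S n ]) 0ℓ) : Set where
  field
    resp-≈   : ∀ {a b} → a ≈ b → a ∈ A → b ∈ A
    0-closed : 0# ∈ A
    +-closed : ∀ {a b} → a ∈ A → b ∈ A → a + b ∈ A
    •-closed : ∀ q {a} → a ∈ A → q • a ∈ A
    *-closed : ∀ {a b} → a ∈ A → b ∈ A → a * b ∈ A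

Commutative : Pred (ℚ[S n ]) 0ℓ → Set
Commutative A = ∀ {a b} → a ∈ A → b ∈ A → a * b ≈ b * a

linearCombination : (ℕ → ℚ) → (ℕ → ℚ[S n ]) → List ℕ → ℚ[S n ]
linearCombination c v ks = sum (map (λ k → c k • v k) ks)

-- The family v is indexed by the k ∈ K; its values outside K play no role.
record IsBasis (A : Pred (ℚ[S n ]) 0ℓ) (K : Pred ℕ 0ℓ) (v : ℕ → ℚ[S n ]) : Set where
  field
    members     : ∀ {k} → k ∈ K → v k ∈ A
    independent : ∀ ks → Unique ks → All (_∈ K) ks → ∀ c →
                  linearCombination c v ks ≈ 0# → All (λ k → c k ≡ 0ℚ) ks
    spanning    : ∀ {a} → a ∈ A →
                  ∃ λ ks → ∃ λ c → All (_∈ K) ks × a ≈ linearCombination c v ks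

Attained : (Permutation′ n → ℕ) → Pred ℕ 0ℓ
Attained f k = ∃ λ σ → f σ ≡ k

classSum : (Permutation′ n → ℕ) → ℕ → ℚ[S n ]
classSum {n} f k = sum (map ⟦_⟧ (filter (λ σ → f σ ℕ.≟ k) (permutations n)))

OppositeSigns : ℤ.ℤ → ℤ.ℤ → Set
OppositeSigns x y = (x ℤ.> ℤ.0ℤ × y ℤ.< ℤ.0ℤ) ⊎ (x ℤ.< ℤ.0ℤ × y ℤ.> ℤ.0ℤ)

oppositeSigns? : ∀ x y → Dec (OppositeSigns x y)
oppositeSigns? x y =
  ((ℤ.0ℤ ℤ.<? x) ×-dec (y ℤ.<? ℤ.0ℤ)) ⊎-dec ((x ℤ.<? ℤ.0ℤ) ×-dec (ℤ.0ℤ ℤ.<? y))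

-- Positions and values are numbered from 0, which does not affect the
-- differences.
value : Permutation′ n → Fin n → ℤ.ℤ
value σ i = ℤ.+ toℕ (σ ⟨$⟩ʳ i)

-- j : Fin m stands for the interior position toℕ j + 1 (numbered from 0) of
-- {0, …, m + 1}; its neighbours are toℕ j and toℕ j + 2.
module _ {m} (σ : Permutation′ (suc (suc m))) (j : Fin m) where

  stepIn stepOut : ℤ.ℤ
  stepIn  = value σ (inject₁ (suc j)) ℤ.- value σ (inject₁ (inject₁ j))
  stepOut = value σ (suc (suc j))     ℤ.- value σ (inject₁ (suc j))

reducedTurningNumber : Permutation′ n → ℕ
reducedTurningNumber {zero}        σ = 0
reducedTurningNumber {suc zero}    σ = 0
reducedTurningNumber {suc (suc m)} σ =
  length (filter (λ j → oppositeSigns? (stepIn σ j) (stepOut σ j)) (allFin m))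

{-# OPTIONS --safe #-}

-- Let T be the zigzag map of [0, 1] onto itself with a linear pieces of slope
-- ±a.  It induces a random permutation, by comparing the order of n uniform
-- points with the order of their images.  Discretely, the possible permutations
-- are encoded by the words of length n over the alphabet of the a pieces, each
-- piece carrying the sign of its slope.  Composing the zigzags with a and b
-- pieces gives one with ab pieces, so that, adding up both choices of the first
-- slope, the resulting elements satisfy R(a) R(b) = 2 R(ab) = R(b) R(a).  The
-- coefficient of σ in R(a) depends only on the number k of turning points of σ;
-- it vanishes for k ≥ a and is positive for k = a − 1.  By triangularity the
-- R(a) span all functions of the reduced turning number.
module Submission where

open import Defs
open import Algebra.Bundles using (module CommutativeMonoid)
open import Data.Bool.Base using (Bool; true; false; not; _xor_; if_then_else_)
import Data.Bool.Properties as Bool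
open import Data.Fin.Base as Fin
  using (Fin; zero; suc; toℕ; fromℕ; fromℕ<; inject₁; opposite; combine; remQuot; punchOut; _<_; _↑ˡ_; _↑ʳ_; _ℕ-ℕ_)
open import Data.Fin.Induction using (<-weakInduction)
open import Data.Fin.Permutation as Perm
  using (Permutation′; permutation; _⟨$⟩ʳ_; _⟨$⟩ˡ_; _∘ₚ_; flip; inverseˡ; inverseʳ)
open import Data.Fin.Properties as Fin using (all?; any?; _<?_)
import Data.Integer.Base as ℤ
import Data.Integer.Properties as ℤ
open import Data.List.Base
  using (List; []; _∷_; _++_; map; foldr; filter; length; allFin; tabulate; cartesianProductWith; deduplicate)
open import Data.List.Membership.Propositional using () renaming (_∈_ to _∈ˡ_)
open import Data.List.Membership.Propositional.Properties
  using (∈-allFin; ∈-cartesianProductWith⁺; ∈-map⁻; ∈-deduplicate⁺; ∈-deduplicate⁻)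
import Data.List.Membership.Setoid as Membership
open import Data.List.Properties using (map-cong; map-∘; map-tabulate; filter-notAll; filter-≐; length-filter; length-tabulate)
open import Data.List.Relation.Unary.All as All using (All; []; _∷_)
open import Data.List.Relation.Unary.AllPairs using ([]; _∷_)
open import Data.List.Relation.Unary.Any as Any using (Any; here; there)
import Data.List.Relation.Unary.Any.Properties as Any
open import Data.List.Relation.Unary.Unique.DecPropositional.Properties using (deduplicate-!)
open import Data.List.Relation.Unary.Unique.Propositional using (Unique)
open import Data.List.Relation.Unary.Unique.Propositional.Properties using (allFin⁺; cartesianProductWith⁺)
import Data.List.Relation.Unary.Unique.Setoid as UniqueSetoid
open import Data.Nat.Base as ℕ using (ℕ; zero; suc; _≥_; z≤n; s≤s; _∸_)
import Data.Nat.Properties as ℕ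
open import Data.Product.Base using (∃; _×_; _,_; proj₁; proj₂; uncurry)
open import Data.Rational.Base as ℚ using (ℚ; 0ℚ; 1ℚ)
import Data.Rational.Properties as ℚ
open import Data.Rational.Solver using (module +-*-Solver)
open import Data.Sum.Base as Sum using (_⊎_; inj₁; inj₂)
open import Data.Vec.Base as Vec using (Vec; []; _∷_; lookup; zipWith)
import Data.Vec.Properties as Vec
open import Function.Base using (_∘_; id)
open import Function.Bundles using (_⇔_; mk⇔; Equivalence)
open import Function.Definitions using (Injective)
open import Level using (0ℓ)
open import Relation.Binary.Bundles using (Setoid)
open import Relation.Binary.Core using (Rel)
open import Relation.Binary.Definitions using (DecidableEquality; tri<; tri≈; tri>)
open import Relation.Binary.PropositionalEquality
  using (_≡_; _≢_; _≗_; refl; sym; trans; cong; cong₂; subst; subst₂; module ≡-Reasoning) renaming (setoid to ≡-setoid)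
open import Relation.Nullary using (¬_)
open import Relation.Nullary.Decidable
  using (Dec; yes; no; does; does-⇔; dec-true; dec-false; _×-dec_; _⊎-dec_; _→-dec_)
open import Relation.Nullary.Negation using (contradiction)
open import Relation.Unary using (Pred; _∈_)

open import Algebra.Properties.CommutativeSemigroup
  (CommutativeMonoid.commutativeSemigroup ℚ.+-0-commutativeMonoid) using (interchange)

-- A point is recorded by its piece together with the rank of its image. Points then compare
-- lexicographically, the second comparison being reversed on falling pieces (`Precedes`). Two such
-- comparisons nest into one, and for a given pair of words exactly one intermediate permutation
-- contributes to a coefficient of the product; this gives `shuffle-*` without any probability. That
-- the coefficients see only the number of turning points is not evident from their definition. They
-- are computed by a recursion along the permutation, in which each interior position acts on
-- functions of the number of letters by one of two linear operators: `switch` at a turning point,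
-- `stay` elsewhere. The operators commute, so the places of the turning points are forgotten. As a
-- power series `switch` is divisible by x and `stay` has constant term 1, whence the triangularity.
-- A single first slope would also see the direction of the first step, as if 1 could be a turning
-- point; adding both slopes removes this, which is why the reduced number appears.

private
  variable
    A B C P Q : Set
    a b m n : ℕ

-- Finite sums

∑ : List A → (A → ℚ) → ℚ
∑ xs f = sumℚ (map f xs)

∑-cong : ∀ (xs : List A) {f g : A → ℚ} → f ≗ g → ∑ xs f ≡ ∑ xs g
∑-cong xs f≗g = cong sumℚ (map-cong f≗g xs)

∑-zero : ∀ (xs : List A) → ∑ xs (λ _ → 0ℚ) ≡ 0ℚ
∑-zero []       = refl
∑-zero (x ∷ xs) = trans (ℚ.+-identityˡ _) (∑-zero xs)

∑-+ : ∀ (xs : List A) (f g : A → ℚ) → ∑ xs (λ x → f x ℚ.+ g x) ≡ ∑ xs f ℚ.+ ∑ xs g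
∑-+ []       f g = refl
∑-+ (x ∷ xs) f g = trans (cong (f x ℚ.+ g x ℚ.+_) (∑-+ xs f g))
  (interchange (f x) (g x) (∑ xs f) (∑ xs g))

∑-*ˡ : ∀ q (xs : List A) (f : A → ℚ) → q ℚ.* ∑ xs f ≡ ∑ xs (λ x → q ℚ.* f x)
∑-*ˡ q []       f = ℚ.*-zeroʳ q
∑-*ˡ q (x ∷ xs) f =
  trans (ℚ.*-distribˡ-+ q (f x) (∑ xs f)) (cong (q ℚ.* f x ℚ.+_) (∑-*ˡ q xs f))

∑-*ʳ : ∀ q (xs : List A) (f : A → ℚ) → ∑ xs f ℚ.* q ≡ ∑ xs (λ x → f x ℚ.* q)
∑-*ʳ q xs f = trans (ℚ.*-comm (∑ xs f) q)
  (trans (∑-*ˡ q xs f) (∑-cong xs λ x → ℚ.*-comm q (f x)))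

∑-++ : ∀ (xs ys : List A) (f : A → ℚ) → ∑ (xs ++ ys) f ≡ ∑ xs f ℚ.+ ∑ ys f
∑-++ []       ys f = sym (ℚ.+-identityˡ _)
∑-++ (x ∷ xs) ys f =
  trans (cong (f x ℚ.+_) (∑-++ xs ys f)) (sym (ℚ.+-assoc (f x) (∑ xs f) (∑ ys f)))

∑-swap : ∀ (xs : List A) (ys : List B) (f : A → B → ℚ) →
         ∑ xs (λ x → ∑ ys (f x)) ≡ ∑ ys (λ y → ∑ xs (λ x → f x y))
∑-swap []       ys f = sym (∑-zero ys)
∑-swap (x ∷ xs) ys f = trans (cong (∑ ys (f x) ℚ.+_) (∑-swap xs ys f)) (sym (∑-+ ys _ _))

∑-map : ∀ (h : A → B) (xs : List A) (f : B → ℚ) → ∑ (map h xs) f ≡ ∑ xs (f ∘ h)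
∑-map h xs f = cong sumℚ (sym (map-∘ xs))

∑-cartesianProductWith : ∀ (h : A → B → C) xs ys (f : C → ℚ) →
  ∑ (cartesianProductWith h xs ys) f ≡ ∑ xs (λ x → ∑ ys (λ y → f (h x y)))
∑-cartesianProductWith h []       ys f = refl
∑-cartesianProductWith h (x ∷ xs) ys f =
  trans (∑-++ (map (h x) ys) _ f)
        (cong₂ ℚ._+_ (∑-map (h x) ys f) (∑-cartesianProductWith h xs ys f))

∑-*-∑ : ∀ (xs : List A) (ys : List B) (f : A → ℚ) (g : B → ℚ) →
        ∑ xs f ℚ.* ∑ ys g ≡ ∑ xs (λ x → ∑ ys (λ y → f x ℚ.* g y))
∑-*-∑ xs ys f g = trans (∑-*ʳ (∑ ys g) xs f) (∑-cong xs λ x → ∑-*ˡ (f x) ys g)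

∑-allFin-suc : ∀ (f : Fin (suc n) → ℚ) →
               ∑ (allFin (suc n)) f ≡ f zero ℚ.+ ∑ (allFin n) (f ∘ suc)
∑-allFin-suc {n} f = cong (f zero ℚ.+_)
  (trans (cong (λ is → ∑ is f) (sym (map-tabulate id suc))) (∑-map suc (allFin n) f))

𝟙 : Dec P → ℚ
𝟙 p? = if does p? then 1ℚ else 0ℚ

𝟙-⇔ : P ⇔ Q → ∀ (p? : Dec P) (q? : Dec Q) → 𝟙 p? ≡ 𝟙 q?
𝟙-⇔ P⇔Q p? q? = cong (if_then 1ℚ else 0ℚ) (does-⇔ P⇔Q p? q?)

𝟙-true : (p? : Dec P) → P → 𝟙 p? ≡ 1ℚ
𝟙-true p? p = cong (if_then 1ℚ else 0ℚ) (dec-true p? p)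

𝟙-false : (p? : Dec P) → ¬ P → 𝟙 p? ≡ 0ℚ
𝟙-false p? ¬p = cong (if_then 1ℚ else 0ℚ) (dec-false p? ¬p)

𝟙-× : (p? : Dec P) (q? : Dec Q) → 𝟙 (p? ×-dec q?) ≡ 𝟙 p? ℚ.* 𝟙 q?
𝟙-× p? q? with does p?
... | true  = sym (ℚ.*-identityˡ (𝟙 q?))
... | false = sym (ℚ.*-zeroˡ (𝟙 q?))

module _ (X : Setoid 0ℓ 0ℓ) where

  open Setoid X using (Carrier) renaming (_≈_ to _∼_; sym to ∼-sym; trans to ∼-trans)

  -- Used to collapse sums over permutations, whose equality is only pointwise; hence the setoid.
  -- The selecting condition is a separate `P?` because it usually arrives in another form, such as
  -- sorting a given word.
  ∑-𝟙 : ∀ {xs c} → UniqueSetoid.Unique X xs → Membership._∈_ X c xs →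
        {P : Carrier → Set} (P? : ∀ x → Dec (P x)) → (∀ x → P x ⇔ x ∼ c) →
        (f : Carrier → ℚ) → (∀ {x} → x ∼ c → f x ≡ f c) →
        ∑ xs (λ x → 𝟙 (P? x) ℚ.* f x) ≡ f c
  ∑-𝟙 {x ∷ xs} {c} (x≁xs ∷ _) (here c∼x) P? P⇔ f f-resp = begin
    𝟙 (P? x) ℚ.* f x ℚ.+ ∑ xs (λ y → 𝟙 (P? y) ℚ.* f y)
      ≡⟨ cong₂ ℚ._+_
           (trans (cong₂ ℚ._*_ (𝟙-true (P? x) (Equivalence.from (P⇔ x) (∼-sym c∼x))) (f-resp (∼-sym c∼x)))
                  (ℚ.*-identityˡ (f c)))
           (vanish x≁xs) ⟩
    f c ℚ.+ 0ℚ
      ≡⟨ ℚ.+-identityʳ (f c) ⟩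
    f c ∎
    where
    open ≡-Reasoning
    vanish : ∀ {ys} → All (λ y → ¬ x ∼ y) ys → ∑ ys (λ y → 𝟙 (P? y) ℚ.* f y) ≡ 0ℚ
    vanish []                = refl
    vanish (_∷_ {y} x≁y x≁ys) = cong₂ ℚ._+_
      (trans (cong (ℚ._* f y) (𝟙-false (P? y) λ p →
                x≁y (∼-sym (∼-trans (Equivalence.to (P⇔ y) p) c∼x))))
             (ℚ.*-zeroˡ (f y)))
      (vanish x≁ys)
  ∑-𝟙 {x ∷ xs} {c} (x≁xs ∷ xs!) (there c∈xs) P? P⇔ f f-resp = begin
    𝟙 (P? x) ℚ.* f x ℚ.+ ∑ xs (λ y → 𝟙 (P? y) ℚ.* f y)
      ≡⟨ cong₂ ℚ._+_
           (trans (cong (ℚ._* f x) (𝟙-false (P? x) λ p →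
                     x≁ x≁xs c∈xs (Equivalence.to (P⇔ x) p)))
                  (ℚ.*-zeroˡ (f x)))
           (∑-𝟙 xs! c∈xs P? P⇔ f f-resp) ⟩
    0ℚ ℚ.+ f c
      ≡⟨ ℚ.+-identityˡ (f c) ⟩
    f c ∎
    where
    open ≡-Reasoning
    x≁ : ∀ {ys} → All (λ y → ¬ x ∼ y) ys → Membership._∈_ X c ys → ¬ x ∼ c
    x≁ (x≁y ∷ _)  (here c∼y)   x∼c = x≁y (∼-trans x∼c c∼y)
    x≁ (_ ∷ x≁ys) (there c∈ys) x∼c = x≁ x≁ys c∈ys x∼c

∑-≟ : ∀ (_≟_ : DecidableEquality A) {xs c} → Unique xs → c ∈ˡ xs → (f : A → ℚ) →
      ∑ xs (λ x → 𝟙 (x ≟ c) ℚ.* f x) ≡ f c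
∑-≟ _≟_ {c = c} xs! c∈xs f =
  ∑-𝟙 (≡-setoid _) xs! c∈xs (_≟ c) (λ _ → mk⇔ id id) f (cong f)

-- Enumerations and reindexing of sums

record Enumerates {A : Set} (xs : List A) : Set where
  field
    unique   : Unique xs
    complete : ∀ x → x ∈ˡ xs

open Enumerates

-- Both sides equal the double sum of `h y` over the pairs with `y ≡ f x`, evaluated in the two
-- orders.
∑-bijection : DecidableEquality B → ∀ {xs : List A} {ys : List B} →
              Enumerates xs → Enumerates ys → ∀ {f : A → B} {g : B → A} →
              (∀ x → g (f x) ≡ x) → (∀ y → f (g y) ≡ y) →
              (h : B → ℚ) → ∑ xs (h ∘ f) ≡ ∑ ys h
∑-bijection _≟_ {xs} {ys} exs eys {f} {g} gf fg h = begin
  ∑ xs (λ x → h (f x))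
    ≡⟨ ∑-cong xs (λ x → ∑-≟ _≟_ (unique eys) (complete eys (f x)) h) ⟨
  ∑ xs (λ x → ∑ ys (λ y → 𝟙 (y ≟ f x) ℚ.* h y))
    ≡⟨ ∑-swap xs ys _ ⟩
  ∑ ys (λ y → ∑ xs (λ x → 𝟙 (y ≟ f x) ℚ.* h y))
    ≡⟨ ∑-cong ys (λ y → ∑-𝟙 (≡-setoid _) (unique exs) (complete exs (g y)) (λ x → y ≟ f x)
         (λ x → mk⇔ (λ y≡fx → trans (sym (gf x)) (cong g (sym y≡fx)))
                    (λ x≡gy → trans (sym (fg y)) (cong f (sym x≡gy))))
         (λ _ → h y) (λ _ → refl)) ⟩
  ∑ ys h ∎
  where open ≡-Reasoning

allFin-enumerates : ∀ n → Enumerates (allFin n)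
allFin-enumerates n = record { unique = allFin⁺ n ; complete = ∈-allFin }

cartesianProductWith-enumerates : ∀ {f : A → B → C} {xs ys} → Enumerates xs → Enumerates ys →
  (∀ {w x y z} → f w y ≡ f x z → w ≡ x × y ≡ z) → (∀ z → ∃ λ x → ∃ λ y → f x y ≡ z) →
  Enumerates (cartesianProductWith f xs ys)
cartesianProductWith-enumerates {f = f} exs eys inj surj = record
  { unique   = cartesianProductWith⁺ f inj (unique exs) (unique eys)
  ; complete = λ z → let (x , y , fxy≡z) = surj z in
      subst (_∈ˡ _) fxy≡z (∈-cartesianProductWith⁺ f (complete exs x) (complete eys y))
  }

words : ∀ a n → List (Vec (Fin a) n)
words a zero    = [] ∷ []
words a (suc n) = cartesianProductWith _∷_ (allFin a) (words a n)

words-enumerates : ∀ a n → Enumerates (words a n)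
words-enumerates a zero    = record { unique = [] ∷ [] ; complete = λ { [] → here refl } }
words-enumerates a (suc n) = cartesianProductWith-enumerates
  (allFin-enumerates a) (words-enumerates a n) Vec.∷-injective (λ { (x ∷ w) → x , w , refl })

∑-words-suc : ∀ a n (f : Vec (Fin a) (suc n) → ℚ) →
              ∑ (words a (suc n)) f ≡ ∑ (allFin a) (λ x → ∑ (words a n) (λ w → f (x ∷ w)))
∑-words-suc a n = ∑-cartesianProductWith _∷_ (allFin a) (words a n)

-- Sorting permutations

module _ {P Q : A → Set} (P? : ∀ x → Dec (P x)) (Q? : ∀ x → Dec (Q x)) (P⊆Q : ∀ x → P x → Q x) where

  length-filter-mono-≤ : ∀ xs → length (filter P? xs) ℕ.≤ length (filter Q? xs)
  length-filter-mono-≤ []       = z≤n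
  length-filter-mono-≤ (x ∷ xs) with P? x | Q? x
  ... | yes p | yes q = s≤s (length-filter-mono-≤ xs)
  ... | yes p | no ¬q = contradiction (P⊆Q x p) ¬q
  ... | no ¬p | yes q = ℕ.m≤n⇒m≤1+n (length-filter-mono-≤ xs)
  ... | no ¬p | no ¬q = length-filter-mono-≤ xs

  length-filter-mono-< : ∀ {xs} → Any (λ x → Q x × ¬ P x) xs →
                         length (filter P? xs) ℕ.< length (filter Q? xs)
  length-filter-mono-< {x ∷ xs} (here (q , ¬p)) with P? x | Q? x
  ... | yes p | _     = contradiction p ¬p
  ... | no _  | yes _ = s≤s (length-filter-mono-≤ xs)
  ... | no _  | no ¬q = contradiction q ¬q
  length-filter-mono-< {x ∷ xs} (there any) with P? x | Q? x
  ... | yes p | yes q = s≤s (length-filter-mono-< any)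
  ... | yes p | no ¬q = contradiction (P⊆Q x p) ¬q
  ... | no ¬p | yes q = ℕ.m≤n⇒m≤1+n (length-filter-mono-< any)
  ... | no ¬p | no ¬q = length-filter-mono-< any

-- If `j` were missed, punching it out of the target would give an injection into a smaller set.
injective⇒surjective : ∀ {f : Fin n → Fin n} → Injective _≡_ _≡_ f → ∀ j → ∃ λ i → f i ≡ j
injective⇒surjective {n = suc n} {f} f-inj j with any? (λ i → f i Fin.≟ j)
... | yes found = found
... | no ¬found = contradiction (Fin.injective⇒≤ avoid-injective) ℕ.1+n≰n
  where
  j≢f : ∀ i → j ≢ f i
  j≢f i j≡fi = ¬found (i , sym j≡fi)
  avoid-injective : Injective _≡_ _≡_ (λ i → punchOut (j≢f i))
  avoid-injective {i} {k} eq = f-inj (Fin.punchOut-injective (j≢f i) (j≢f k) eq)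

injective⇒permutation : (f : Fin n → Fin n) → Injective _≡_ _≡_ f → Permutation′ n
injective⇒permutation f f-inj = permutation f
  (λ j → proj₁ (injective⇒surjective f-inj j))
  (λ j → proj₂ (injective⇒surjective f-inj j))
  (λ i → f-inj (proj₂ (injective⇒surjective f-inj (f i))))

module _ {_≺_ : Rel (Fin n) 0ℓ} (_≺?_ : ∀ i j → Dec (i ≺ j))
         (≺-irrefl : ∀ {i} → ¬ (i ≺ i))
         (≺-trans : ∀ {i j k} → i ≺ j → j ≺ k → i ≺ k)
         (≺-connected : ∀ {i j} → i ≢ j → i ≺ j ⊎ j ≺ i)
         where

  private
    below : Fin n → ℕ
    below i = length (filter (_≺? i) (allFin n))

    below<n : ∀ i → below i ℕ.< n
    below<n i = subst (below i ℕ.<_) (length-tabulate id)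
      (filter-notAll (_≺? i) (allFin n)
        (Any.map (λ { refl → ≺-irrefl }) (∈-allFin i)))

    rank : Fin n → Fin n
    rank i = fromℕ< (below<n i)

    rank-mono : ∀ {i j} → i ≺ j → rank i < rank j
    rank-mono {i} {j} i≺j = subst₂ ℕ._<_
      (sym (Fin.toℕ-fromℕ< (below<n i))) (sym (Fin.toℕ-fromℕ< (below<n j)))
      (length-filter-mono-< (_≺? i) (_≺? j) (λ k k≺i → ≺-trans k≺i i≺j)
        (Any.map (λ { refl → i≺j , ≺-irrefl }) (∈-allFin i)))

    rank-injective : Injective _≡_ _≡_ rank
    rank-injective {i} {j} eq with i Fin.≟ j
    ... | yes i≡j = i≡j
    ... | no  i≢j with ≺-connected i≢j
    ...   | inj₁ i≺j = contradiction eq (Fin.<⇒≢ (rank-mono i≺j))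
    ...   | inj₂ j≺i = contradiction (sym eq) (Fin.<⇒≢ (rank-mono j≺i))

    rank-mono⁻¹ : ∀ {i j} → rank i < rank j → i ≺ j
    rank-mono⁻¹ {i} {j} ri<rj with i Fin.≟ j
    ... | yes refl = contradiction ri<rj (Fin.<-irrefl refl)
    ... | no  i≢j with ≺-connected i≢j
    ...   | inj₁ i≺j = i≺j
    ...   | inj₂ j≺i = contradiction ri<rj (Fin.<-asym (rank-mono j≺i))

  -- Each element is sent to the number of its predecessors. Irreflexivity keeps this number below
  -- `n` and, with transitivity, makes it strictly monotone; connectedness then makes it injective.
  rankPermutation : ∃ λ (ρ : Permutation′ n) → ∀ i j → (ρ ⟨$⟩ʳ i < ρ ⟨$⟩ʳ j) ⇔ i ≺ j
  rankPermutation = injective⇒permutation rank rank-injective , λ i j → mk⇔ rank-mono⁻¹ rank-mono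

mono⇒≤ : ∀ (f : Fin n → Fin n) → (∀ {i j} → i < j → f i < f j) → ∀ i → i Fin.≤ f i
mono⇒≤ {n = suc n} f f-mono = <-weakInduction (λ i → i Fin.≤ f i) z≤n step
  where
  step : ∀ i → inject₁ i Fin.≤ f (inject₁ i) → suc i Fin.≤ f (suc i)
  step i ih = ℕ.≤-<-trans (subst (ℕ._≤ toℕ (f (inject₁ i))) (Fin.toℕ-inject₁ i) ih)
    (f-mono (ℕ.≤-reflexive (cong suc (Fin.toℕ-inject₁ i))))

⟨$⟩ʳ-injective : ∀ (σ : Permutation′ n) → Injective _≡_ _≡_ (σ ⟨$⟩ʳ_)
⟨$⟩ʳ-injective σ eq = trans (sym (inverseˡ σ)) (trans (cong (σ ⟨$⟩ˡ_) eq) (inverseˡ σ))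

order-reflecting⇒≤ : ∀ (σ ρ : Permutation′ n) →
  (∀ i j → σ ⟨$⟩ʳ i < σ ⟨$⟩ʳ j → ρ ⟨$⟩ʳ i < ρ ⟨$⟩ʳ j) → ∀ i → σ ⟨$⟩ʳ i Fin.≤ ρ ⟨$⟩ʳ i
order-reflecting⇒≤ σ ρ σ⇒ρ i =
  subst (λ k → σ ⟨$⟩ʳ i Fin.≤ ρ ⟨$⟩ʳ k) (inverseˡ σ)
    (mono⇒≤ (λ k → ρ ⟨$⟩ʳ (σ ⟨$⟩ˡ k))
       (λ {k} {l} k<l → σ⇒ρ _ _ (subst₂ _<_ (sym (inverseʳ σ)) (sym (inverseʳ σ)) k<l))
       (σ ⟨$⟩ʳ i))

-- The composite of `ρ` with the inverse of `σ` is a strictly monotone self-map of `Fin n`, so it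
-- lies above the identity; by totality the hypothesis also holds with the roles exchanged. This is
-- the uniqueness of a sorting permutation.
order-reflecting⇒≈ : ∀ (σ ρ : Permutation′ n) →
  (∀ i j → σ ⟨$⟩ʳ i < σ ⟨$⟩ʳ j → ρ ⟨$⟩ʳ i < ρ ⟨$⟩ʳ j) → σ Perm.≈ ρ
order-reflecting⇒≈ σ ρ σ⇒ρ i =
  Fin.≤-antisym (order-reflecting⇒≤ σ ρ σ⇒ρ i) (order-reflecting⇒≤ ρ σ ρ⇒σ i)
  where
  ρ⇒σ : ∀ i j → ρ ⟨$⟩ʳ i < ρ ⟨$⟩ʳ j → σ ⟨$⟩ʳ i < σ ⟨$⟩ʳ j
  ρ⇒σ i j ρi<ρj with Fin.<-cmp (σ ⟨$⟩ʳ i) (σ ⟨$⟩ʳ j)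
  ... | tri< σi<σj _ _ = σi<σj
  ... | tri≈ _ σi≡σj _ = contradiction ρi<ρj (Fin.<-irrefl (cong (ρ ⟨$⟩ʳ_) (⟨$⟩ʳ-injective σ σi≡σj)))
  ... | tri> _ _ σj<σi = contradiction ρi<ρj (Fin.<-asym (σ⇒ρ j i σj<σi))

-- Signed alphabets and their words

private
  variable
    P′ P″ Q′ Q″ : Set

-- The letters are ordered and carry signs; P and Q are the two possible
-- orders of the carriers of x and y, compared directly if the common letter
-- is positive and in reverse if it is negative.
Lex : (Fin a → Bool) → Fin a → Fin a → Set → Set → Set
Lex L x y P Q = x < y ⊎ (x ≡ y × (if L x then P else Q))

if-map : ∀ s → (P → P′) → (Q → Q′) → (if s then P else Q) → (if s then P′ else Q′)
if-map true  f g = f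
if-map false f g = g

if-dec : ∀ s → Dec P → Dec Q → Dec (if s then P else Q)
if-dec true  p? q? = p?
if-dec false p? q? = q?

module _ (L : Fin a → Bool) where

  Lex-map : ∀ {x y} → (P → P′) → (Q → Q′) → Lex L x y P Q → Lex L x y P′ Q′
  Lex-map {x = x} f g = Sum.map₂ λ (x≡y , s) → x≡y , if-map (L x) f g s

  Lex-cong : ∀ {x y} → P ⇔ P′ → Q ⇔ Q′ → Lex L x y P Q ⇔ Lex L x y P′ Q′
  Lex-cong p q = mk⇔ (Lex-map (p .Equivalence.to) (q .Equivalence.to))
                     (Lex-map (p .Equivalence.from) (q .Equivalence.from))

  lex? : ∀ x y → Dec P → Dec Q → Dec (Lex L x y P Q)
  lex? x y p? q? = (x <? y) ⊎-dec ((x Fin.≟ y) ×-dec if-dec (L x) p? q?)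

  Lex-irrefl : ∀ {x} → ¬ P → ¬ Lex L x x P P
  Lex-irrefl ¬p (inj₁ x<x) = Fin.<-irrefl refl x<x
  Lex-irrefl {x = x} ¬p (inj₂ (_ , s)) with L x
  ... | true  = ¬p s
  ... | false = ¬p s

  Lex-trans : ∀ {x y z} → (P → P′ → P″) → (Q → Q′ → Q″) →
              Lex L x y P Q → Lex L y z P′ Q′ → Lex L x z P″ Q″
  Lex-trans f g (inj₁ x<y)        (inj₁ y<z)        = inj₁ (Fin.<-trans x<y y<z)
  Lex-trans f g (inj₁ x<y)        (inj₂ (refl , _)) = inj₁ x<y
  Lex-trans f g (inj₂ (refl , _)) (inj₁ y<z)        = inj₁ y<z
  Lex-trans {x = x} f g (inj₂ (refl , s)) (inj₂ (refl , t)) with L x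
  ... | true  = inj₂ (refl , f s t)
  ... | false = inj₂ (refl , g s t)

  Lex-connected : ∀ x y → P ⊎ Q → Lex L x y P Q ⊎ Lex L y x Q P
  Lex-connected x y p⊎q with Fin.<-cmp x y
  ... | tri< x<y _ _ = inj₁ (inj₁ x<y)
  ... | tri> _ _ y<x = inj₂ (inj₁ y<x)
  ... | tri≈ _ refl _ with L x
  Lex-connected x y (inj₁ p) | tri≈ _ refl _ | true  = inj₁ (inj₂ (refl , p))
  Lex-connected x y (inj₁ p) | tri≈ _ refl _ | false = inj₂ (inj₂ (refl , p))
  Lex-connected x y (inj₂ q) | tri≈ _ refl _ | true  = inj₂ (inj₂ (refl , q))
  Lex-connected x y (inj₂ q) | tri≈ _ refl _ | false = inj₁ (inj₂ (refl , q))

-- Substituting one signed alphabet into another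

orient : (Fin a → Bool) → Fin a → Fin b → Fin b
orient L x y = if L x then y else opposite y

orient-involutive : ∀ (L : Fin a → Bool) x (y : Fin b) → orient L x (orient L x y) ≡ y
orient-involutive L x y with L x
... | true  = refl
... | false = Fin.opposite-involutive y

-- The piece `x` is cut into `b` parts, named by the piece `y` that contains their image. Over a
-- falling piece these parts occur from right to left.
place : (Fin a → Bool) → Fin a → Fin b → Fin (a ℕ.* b)
place L x y = combine x (orient L x y)

unplace : (Fin a → Bool) → ∀ b → Fin (a ℕ.* b) → Fin a × Fin b
unplace L b z = uncurry (λ x y → x , orient L x y) (remQuot b z)

infixl 7 _⋆_

-- Each letter x of L is replaced by a copy of M, reversed and with opposite
-- signs if x is negative.
_⋆_ : (Fin a → Bool) → (Fin b → Bool) → Fin (a ℕ.* b) → Bool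
_⋆_ {b = b} L M z = uncurry (λ x y → if L x then M y else not (M (opposite y))) (remQuot b z)

place-unplace : ∀ (L : Fin a → Bool) (z : Fin (a ℕ.* b)) → uncurry (place L) (unplace L b z) ≡ z
place-unplace {a} {b} L z =
  let (x , y) = remQuot {a} b z in
  trans (cong (combine x) (orient-involutive L x y)) (Fin.combine-remQuot {a} b z)

unplace-place : ∀ (L : Fin a → Bool) (x : Fin a) (y : Fin b) → unplace L b (place L x y) ≡ (x , y)
unplace-place L x y =
  trans (cong (uncurry (λ x y → x , orient L x y)) (Fin.remQuot-combine x (orient L x y)))
        (cong (x ,_) (orient-involutive L x y))

⋆-place : ∀ (L : Fin a → Bool) (M : Fin b → Bool) x y →
          (L ⋆ M) (place L x y) ≡ (if L x then M y else not (M y))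
⋆-place L M x y = trans
  (cong (uncurry (λ x y → if L x then M y else not (M (opposite y))))
        (Fin.remQuot-combine x (orient L x y)))
  unorient
  where
  unorient : (if L x then M (orient L x y) else not (M (opposite (orient L x y))))
         ≡ (if L x then M y else not (M y))
  unorient with L x
  ... | true  = refl
  ... | false = cong (not ∘ M) (Fin.opposite-involutive y)

combine-monoʳ-< : ∀ (x : Fin a) {y y′ : Fin b} → y < y′ → combine x y < combine x y′
combine-monoʳ-< {b = b} x {y} {y′} y<y′ =
  subst₂ ℕ._<_ (sym (Fin.toℕ-combine x y)) (sym (Fin.toℕ-combine x y′))
    (ℕ.+-monoʳ-< (b ℕ.* toℕ x) y<y′)

opposite-anti-< : ∀ {y y′ : Fin b} → y < y′ → opposite y′ < opposite y
opposite-anti-< {b = b} {y} {y′} y<y′ =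
  subst₂ ℕ._<_ (sym (Fin.opposite-prop y′)) (sym (Fin.opposite-prop y))
    (ℕ.∸-monoʳ-< (s≤s y<y′) (Fin.toℕ<n y′))

Lex-monotone : ∀ {c} (K : Fin c → Bool) (M : Fin b → Bool) {g : Fin b → Fin c} →
  (∀ {y y′} → y < y′ → g y < g y′) → (∀ y → K (g y) ≡ M y) →
  ∀ y y′ → Lex K (g y) (g y′) P Q ⇔ Lex M y y′ P Q
Lex-monotone {P = P} {Q} K M {g} g-mono Kg≗M y y′ with Fin.<-cmp y y′
... | tri< y<y′ _ _ = mk⇔ (λ _ → inj₁ y<y′) (λ _ → inj₁ (g-mono y<y′))
... | tri≈ y≮y refl _ = mk⇔
  (λ { (inj₁ z<z)     → contradiction z<z (Fin.<-irrefl refl)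
     ; (inj₂ (_ , s)) → inj₂ (refl , subst (if_then P else Q) (Kg≗M y) s) })
  (λ { (inj₁ y<y)     → contradiction y<y y≮y
     ; (inj₂ (_ , s)) → inj₂ (refl , subst (if_then P else Q) (sym (Kg≗M y)) s) })
... | tri> y≮y′ y≢y′ y′<y = mk⇔
  (λ { (inj₁ z<z′)       → contradiction z<z′ (Fin.<-asym (g-mono y′<y))
     ; (inj₂ (z≡z′ , _)) → contradiction (sym z≡z′) (Fin.<⇒≢ (g-mono y′<y)) })
  (λ { (inj₁ y<y′)       → contradiction y<y′ y≮y′
     ; (inj₂ (y≡y′ , _)) → contradiction y≡y′ y≢y′ })

if-not : ∀ s → (if not s then P else Q) ≡ (if s then Q else P)
if-not true  = refl
if-not false = refl

-- Turning the alphabet around reverses the comparison of distinct letters; at equal letters the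
-- flipped sign exchanges `P` and `Q`, which has the same effect.
Lex-antitone : ∀ {c} (K : Fin c → Bool) (M : Fin b → Bool) {g : Fin b → Fin c} →
  (∀ {y y′} → y < y′ → g y′ < g y) → (∀ y → K (g y) ≡ not (M y)) →
  ∀ y y′ → Lex K (g y) (g y′) P Q ⇔ Lex M y′ y Q P
Lex-antitone {P = P} {Q} K M {g} g-anti Kg≗M y y′ with Fin.<-cmp y y′
... | tri> _ _ y′<y = mk⇔ (λ _ → inj₁ y′<y) (λ _ → inj₁ (g-anti y′<y))
... | tri≈ y≮y refl _ = mk⇔
  (λ { (inj₁ z<z)     → contradiction z<z (Fin.<-irrefl refl)
     ; (inj₂ (_ , s)) → inj₂ (refl , subst id sign≡ s) })
  (λ { (inj₁ y<y)     → contradiction y<y y≮y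
     ; (inj₂ (_ , s)) → inj₂ (refl , subst id (sym sign≡) s) })
  where
  sign≡ : (if K (g y) then P else Q) ≡ (if M y then Q else P)
  sign≡ = trans (cong (if_then P else Q) (Kg≗M y)) (if-not (M y))
... | tri< y<y′ y≢y′ y′≮y = mk⇔
  (λ { (inj₁ z<z′)       → contradiction z<z′ (Fin.<-asym (g-anti y<y′))
     ; (inj₂ (z≡z′ , _)) → contradiction (sym z≡z′) (Fin.<⇒≢ (g-anti y<y′)) })
  (λ { (inj₁ y′<y)       → contradiction y′<y y′≮y
     ; (inj₂ (y′≡y , _)) → contradiction (sym y′≡y) y≢y′ })

Lex-place-same : ∀ (L : Fin a → Bool) (M : Fin b → Bool) x y y′ →
  Lex (L ⋆ M) (place L x y) (place L x y′) P Q ⇔ (if L x then Lex M y y′ P Q else Lex M y′ y Q P)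
Lex-place-same L M x y y′ with L x | ⋆-place L M x
... | true  | ⋆-place-x = Lex-monotone (L ⋆ M) M (combine-monoʳ-< x) ⋆-place-x y y′
... | false | ⋆-place-x =
  Lex-antitone (L ⋆ M) M (λ y<y′ → combine-monoʳ-< x (opposite-anti-< y<y′)) ⋆-place-x y y′

-- The first letters decide unless they agree. If they do, the images are compared through `M`, in
-- reverse over a negative letter, and the copy of `M` inserted there is turned around accordingly.
Lex-place : ∀ (L : Fin a → Bool) (M : Fin b → Bool) x x′ y y′ →
  Lex (L ⋆ M) (place L x y) (place L x′ y′) P Q ⇔ Lex L x x′ (Lex M y y′ P Q) (Lex M y′ y Q P)
Lex-place {P = P} {Q} L M x x′ y y′ with Fin.<-cmp x x′
... | tri< x<x′ _ _ = mk⇔ (λ _ → inj₁ x<x′) (λ _ → inj₁ (Fin.combine-monoˡ-< _ _ x<x′))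
... | tri> x≮x′ x≢x′ x′<x = mk⇔
  (λ { (inj₁ z<z′)       → contradiction z<z′ (Fin.<-asym z′<z)
     ; (inj₂ (z≡z′ , _)) → contradiction (sym z≡z′) (Fin.<⇒≢ z′<z) })
  (λ { (inj₁ x<x′)       → contradiction x<x′ x≮x′
     ; (inj₂ (x≡x′ , _)) → contradiction x≡x′ x≢x′ })
  where
  z′<z : place L x′ y′ < place L x y
  z′<z = Fin.combine-monoˡ-< _ _ x′<x
... | tri≈ x≮x refl _ = mk⇔
  (λ l → inj₂ (refl , Equivalence.to (Lex-place-same L M x y y′) l))
  (λ { (inj₁ x<x)     → contradiction x<x x≮x
     ; (inj₂ (_ , l)) → Equivalence.from (Lex-place-same L M x y y′) l })

-- Words compatible with a permutation, and the product of shuffles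

module _ (L : Fin a → Bool) where

  -- Here `u i` is the piece that contains the point `i` and `x i` the rank of its image; the
  -- relation is the order of the points themselves.
  Precedes : (Fin n → Fin a) → (Fin n → Fin m) → Rel (Fin n) 0ℓ
  Precedes u x i j = Lex L (u i) (u j) (x i < x j) (x j < x i)

  precedes? : ∀ (u : Fin n → Fin a) (x : Fin n → Fin m) i j → Dec (Precedes u x i j)
  precedes? u x i j = lex? L (u i) (u j) (x i <? x j) (x j <? x i)

  Lex-resp : ∀ {c c′ d d′} {y y′ z z′ : Fin m} → c ≡ c′ → d ≡ d′ → y ≡ y′ → z ≡ z′ →
             Lex L c d (y < z) (z < y) → Lex L c′ d′ (y′ < z′) (z′ < y′)
  Lex-resp refl refl refl refl = id

  Compatible : (Fin n → Fin a) → (Fin n → Fin m) → Set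
  Compatible u x = ∀ i j → i < j → Precedes u x i j

  compatible? : ∀ (u : Fin n → Fin a) (x : Fin n → Fin m) → Dec (Compatible u x)
  compatible? u x = all? λ i → all? λ j → (i <? j) →-dec precedes? u x i j

  Compatible-resp : ∀ {u u′ : Fin n → Fin a} {x x′ : Fin n → Fin m} → u ≗ u′ → x ≗ x′ →
                    Compatible u x → Compatible u′ x′
  Compatible-resp u≗ x≗ c i j i<j = Lex-resp (u≗ i) (u≗ j) (x≗ i) (x≗ j) (c i j i<j)

  -- For injective `x` the order is total, so this one implication already makes `σ` the ranking by
  -- `Precedes`.
  Sorts : (Fin n → Fin a) → (Fin n → Fin m) → Permutation′ n → Set
  Sorts u x σ = ∀ i j → σ ⟨$⟩ʳ i < σ ⟨$⟩ʳ j → Precedes u x i j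

  sorts? : ∀ (u : Fin n → Fin a) (x : Fin n → Fin m) σ → Dec (Sorts u x σ)
  sorts? u x σ = all? λ i → all? λ j → (σ ⟨$⟩ʳ i <? σ ⟨$⟩ʳ j) →-dec precedes? u x i j

  Compatible⇔Sorts : ∀ (u : Fin n → Fin a) (π σ : Permutation′ n) →
    Compatible (u ∘ (σ ⟨$⟩ˡ_)) (flip σ ∘ₚ π ⟨$⟩ʳ_) ⇔ Sorts u (π ⟨$⟩ʳ_) σ
  Compatible⇔Sorts u π σ = mk⇔
    (λ c i j σi<σj → Lex-resp (cong u (inverseˡ σ)) (cong u (inverseˡ σ))
      (cong (π ⟨$⟩ʳ_) (inverseˡ σ)) (cong (π ⟨$⟩ʳ_) (inverseˡ σ)) (c _ _ σi<σj))
    (λ s i j i<j → s _ _ (subst₂ _<_ (sym (inverseʳ σ)) (sym (inverseʳ σ)) i<j))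

  sortingPermutation : ∀ (u : Fin n → Fin a) (π : Permutation′ n) → ∃ λ (ρ : Permutation′ n) →
    ∀ i j → (ρ ⟨$⟩ʳ i < ρ ⟨$⟩ʳ j) ⇔ Precedes u (π ⟨$⟩ʳ_) i j
  sortingPermutation u π = rankPermutation (precedes? u (π ⟨$⟩ʳ_))
    (Lex-irrefl L (Fin.<-irrefl refl))
    (λ {i} {j} {k} → Lex-trans L {x = u i} {u j} {u k} Fin.<-trans (λ q q′ → Fin.<-trans q′ q))
    (λ {i} {j} i≢j → Lex-connected L (u i) (u j) (π-connected i≢j))
    where
    π-connected : ∀ {i j} → i ≢ j → π ⟨$⟩ʳ i < π ⟨$⟩ʳ j ⊎ π ⟨$⟩ʳ j < π ⟨$⟩ʳ i
    π-connected i≢j with Fin.<-cmp (π ⟨$⟩ʳ _) (π ⟨$⟩ʳ _)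
    ... | tri< πi<πj _ _ = inj₁ πi<πj
    ... | tri≈ _ πi≡πj _ = contradiction (⟨$⟩ʳ-injective π πi≡πj) i≢j
    ... | tri> _ _ πj<πi = inj₂ πj<πi

-- Up to normalization and inversion this is the distribution of a riffle shuffle with `a` piles,
-- those at negative letters being turned over.
shuffle : (Fin a → Bool) → ∀ n → ℚ[S n ]
shuffle {a} L n = record
  { to   = λ σ → ∑ (words a n) λ w → 𝟙 (compatible? L (lookup w) (σ ⟨$⟩ʳ_))
  ; cong = λ {σ} {τ} σ≈τ → ∑-cong (words a n) λ w → 𝟙-⇔
      (mk⇔ (Compatible-resp L (λ _ → refl) σ≈τ) (Compatible-resp L (λ _ → refl) (sym ∘ σ≈τ)))
      (compatible? L (lookup w) (σ ⟨$⟩ʳ_)) (compatible? L (lookup w) (τ ⟨$⟩ʳ_))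
  }

Compatible-≗ : ∀ {L L′ : Fin a → Bool} → L ≗ L′ → ∀ (u : Fin n → Fin a) (x : Fin n → Fin m) →
               Compatible L u x → Compatible L′ u x
Compatible-≗ L≗L′ u x c i j i<j = Sum.map₂
  (λ (eq , s) → eq , subst (if_then x i < x j else x j < x i) (L≗L′ (u i)) s) (c i j i<j)

shuffle-≗ : ∀ {L L′ : Fin a → Bool} → L ≗ L′ → shuffle L n ≈ shuffle L′ n
shuffle-≗ {a} {n} {L} {L′} L≗L′ σ = ∑-cong (words a n) λ w → 𝟙-⇔
  (mk⇔ (Compatible-≗ L≗L′ (lookup w) (σ ⟨$⟩ʳ_)) (Compatible-≗ (sym ∘ L≗L′) (lookup w) (σ ⟨$⟩ʳ_)))
  (compatible? L (lookup w) (σ ⟨$⟩ʳ_)) (compatible? L′ (lookup w) (σ ⟨$⟩ʳ_))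

-- Carrying the words along `σ` makes the word and `π` independent of `σ`. What remains is a
-- condition on `σ` that a single permutation satisfies.
shuffle-flip-∘ₚ : ∀ (M : Fin b → Bool) (π σ : Permutation′ n) →
  coeff (shuffle M n) (flip σ ∘ₚ π) ≡ ∑ (words b n) λ w → 𝟙 (sorts? M (lookup w) (π ⟨$⟩ʳ_) σ)
shuffle-flip-∘ₚ {b} {n} M π σ = sym (trans
  (∑-cong (words b n) λ w → 𝟙-⇔ (sorts⇔ w) (sorts? M (lookup w) (π ⟨$⟩ʳ_) σ)
    (compatible? M (lookup (rearrange (σ ⟨$⟩ˡ_) w)) (flip σ ∘ₚ π ⟨$⟩ʳ_)))
  (∑-bijection (Vec.≡-dec Fin._≟_) (words-enumerates b n) (words-enumerates b n)
    {rearrange (σ ⟨$⟩ˡ_)} {rearrange (σ ⟨$⟩ʳ_)}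
    (rearrange-inverse (σ ⟨$⟩ʳ_) (σ ⟨$⟩ˡ_) (λ i → inverseˡ σ)) 
    (rearrange-inverse (σ ⟨$⟩ˡ_) (σ ⟨$⟩ʳ_) (λ i → inverseʳ σ))
    (λ w → 𝟙 (compatible? M (lookup w) (flip σ ∘ₚ π ⟨$⟩ʳ_)))))
  where
  rearrange : (Fin n → Fin n) → Vec (Fin b) n → Vec (Fin b) n
  rearrange p w = Vec.tabulate (lookup w ∘ p)

  rearrange-inverse : ∀ (p q : Fin n → Fin n) → (∀ i → q (p i) ≡ i) →
                      ∀ w → rearrange p (rearrange q w) ≡ w
  rearrange-inverse p q qp w = trans
    (Vec.tabulate-cong λ i → trans (Vec.lookup∘tabulate (lookup w ∘ q) (p i)) (cong (lookup w) (qp i)))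
    (Vec.tabulate∘lookup w)

  sorts⇔ : ∀ w → Sorts M (lookup w) (π ⟨$⟩ʳ_) σ ⇔
                 Compatible M (lookup (rearrange (σ ⟨$⟩ˡ_) w)) (flip σ ∘ₚ π ⟨$⟩ʳ_)
  sorts⇔ w = mk⇔
    (λ s → Compatible-resp M (sym ∘ lookup-rearrange) (λ _ → refl)
             (Equivalence.from (Compatible⇔Sorts M (lookup w) π σ) s))
    (λ c → Equivalence.to (Compatible⇔Sorts M (lookup w) π σ)
             (Compatible-resp M lookup-rearrange (λ _ → refl) c))
    where
    lookup-rearrange : lookup (rearrange (σ ⟨$⟩ˡ_) w) ≗ lookup w ∘ (σ ⟨$⟩ˡ_)
    lookup-rearrange = Vec.lookup∘tabulate (lookup w ∘ (σ ⟨$⟩ˡ_))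

∑-place : ∀ (L : Fin a → Bool) b n (h : Vec (Fin (a ℕ.* b)) n → ℚ) →
  ∑ (words a n) (λ u → ∑ (words b n) (λ w → h (zipWith (place L) u w))) ≡ ∑ (words (a ℕ.* b) n) h
∑-place {a} L b n h = trans
  (sym (∑-cartesianProductWith _,_ (words a n) (words b n) (h ∘ uncurry (zipWith (place L)))))
  (∑-bijection (Vec.≡-dec Fin._≟_)
    (cartesianProductWith-enumerates (words-enumerates a n) (words-enumerates b n)
      (λ { refl → refl , refl }) (λ (u , w) → u , w , refl))
    (words-enumerates (a ℕ.* b) n) {g = unzipPlace} (uncurry unzip-zip) zip-unzip h)
  where
  unzipPlace : ∀ {n} → Vec (Fin (a ℕ.* b)) n → Vec (Fin a) n × Vec (Fin b) n
  unzipPlace z = Vec.map (proj₁ ∘ unplace L b) z , Vec.map (proj₂ ∘ unplace L b) z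

  unzip-zip : ∀ {n} (u : Vec (Fin a) n) (w : Vec (Fin b) n) →
              unzipPlace (zipWith (place L) u w) ≡ (u , w)
  unzip-zip []      []      = refl
  unzip-zip (x ∷ u) (y ∷ w) = cong₂ (λ (x , y) (u , w) → x ∷ u , y ∷ w)
    (unplace-place L x y) (unzip-zip u w)

  zip-unzip : ∀ {n} (z : Vec (Fin (a ℕ.* b)) n) → uncurry (zipWith (place L)) (unzipPlace z) ≡ z
  zip-unzip []      = refl
  zip-unzip (k ∷ z) = cong₂ _∷_ (place-unplace L k) (zip-unzip z)

-- `ρ` ranks the intermediate points, so a comparison of its values is a comparison through `M`, and
-- `Lex-place` nests it into the one through `L`.
Compatible-⋆ : ∀ (L : Fin a → Bool) (M : Fin b → Bool) u w (π ρ : Permutation′ n) →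
  (∀ i j → (ρ ⟨$⟩ʳ i < ρ ⟨$⟩ʳ j) ⇔ Precedes M (lookup w) (π ⟨$⟩ʳ_) i j) →
  Compatible L (lookup u) (ρ ⟨$⟩ʳ_) ⇔
  Compatible (L ⋆ M) (lookup (zipWith (place L) u w)) (π ⟨$⟩ʳ_)
Compatible-⋆ L M u w π ρ ρ-sorts = mk⇔
  (λ c i j i<j → Lex-resp (L ⋆ M) (sym (placed i)) (sym (placed j)) refl refl
    (Equivalence.from (Lex-place L M (lookup u i) (lookup u j) (lookup w i) (lookup w j))
      (Equivalence.to (Lex-cong L (ρ-sorts i j) (ρ-sorts j i)) (c i j i<j))))
  (λ c i j i<j → Equivalence.from (Lex-cong L (ρ-sorts i j) (ρ-sorts j i))
    (Equivalence.to (Lex-place L M (lookup u i) (lookup u j) (lookup w i) (lookup w j))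
      (Lex-resp (L ⋆ M) (placed i) (placed j) refl refl (c i j i<j))))
  where
  placed : ∀ i → lookup (zipWith (place L) u w) i ≡ place L (lookup u i) (lookup w i)
  placed i = Vec.lookup-zipWith (place L) i u w

-- Once the sum over `σ` is innermost, each pair of words leaves only the ranking `ρ` of the
-- intermediate points, and pairs of words correspond to words over the composite alphabet.
shuffle-* : ∀ (L : Fin a → Bool) (M : Fin b → Bool) → shuffle L n * shuffle M n ≈ shuffle (L ⋆ M) n
shuffle-* {a} {b} {n} L M π = begin
  ∑ Sₙ (λ σ → coeff (shuffle L n) σ ℚ.* coeff (shuffle M n) (flip σ ∘ₚ π))
    ≡⟨ ∑-cong Sₙ (λ σ → cong (coeff (shuffle L n) σ ℚ.*_) (shuffle-flip-∘ₚ M π σ)) ⟩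
  ∑ Sₙ (λ σ → ∑ (words a n) (λ u → 𝟙 (C? u σ)) ℚ.* ∑ (words b n) (λ w → 𝟙 (D? w σ)))
    ≡⟨ ∑-cong Sₙ (λ σ → ∑-*-∑ (words a n) (words b n) _ _) ⟩
  ∑ Sₙ (λ σ → ∑ (words a n) (λ u → ∑ (words b n) (λ w → 𝟙 (C? u σ) ℚ.* 𝟙 (D? w σ))))
    ≡⟨ ∑-swap Sₙ (words a n) _ ⟩
  ∑ (words a n) (λ u → ∑ Sₙ (λ σ → ∑ (words b n) (λ w → 𝟙 (C? u σ) ℚ.* 𝟙 (D? w σ))))
    ≡⟨ ∑-cong (words a n) (λ u → ∑-swap Sₙ (words b n) _) ⟩
  ∑ (words a n) (λ u → ∑ (words b n) (λ w → ∑ Sₙ (λ σ → 𝟙 (C? u σ) ℚ.* 𝟙 (D? w σ))))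
    ≡⟨ ∑-cong (words a n) (λ u → ∑-cong (words b n) (λ w → middle u w)) ⟩
  ∑ (words a n) (λ u → ∑ (words b n) (λ w → 𝟙 (E? (zipWith (place L) u w))))
    ≡⟨ ∑-place L b n (λ z → 𝟙 (E? z)) ⟩
  ∑ (words (a ℕ.* b) n) (λ z → 𝟙 (E? z)) ∎
  where
  open ≡-Reasoning
  Sₙ : List (Permutation′ n)
  Sₙ = permutations n
  C? : ∀ u (σ : Permutation′ n) → Dec (Compatible L (lookup u) (σ ⟨$⟩ʳ_))
  C? u σ = compatible? L (lookup u) (σ ⟨$⟩ʳ_)
  D? : ∀ w (σ : Permutation′ n) → Dec (Sorts M (lookup w) (π ⟨$⟩ʳ_) σ)
  D? w σ = sorts? M (lookup w) (π ⟨$⟩ʳ_) σ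
  E? : ∀ z → Dec (Compatible (L ⋆ M) (lookup z) (π ⟨$⟩ʳ_))
  E? z = compatible? (L ⋆ M) (lookup z) (π ⟨$⟩ʳ_)
  middle : ∀ u w → ∑ Sₙ (λ σ → 𝟙 (C? u σ) ℚ.* 𝟙 (D? w σ)) ≡ 𝟙 (E? (zipWith (place L) u w))
  middle u w = begin
    ∑ Sₙ (λ σ → 𝟙 (C? u σ) ℚ.* 𝟙 (D? w σ))
      ≡⟨ ∑-cong Sₙ (λ σ → ℚ.*-comm (𝟙 (C? u σ)) (𝟙 (D? w σ))) ⟩
    ∑ Sₙ (λ σ → 𝟙 (D? w σ) ℚ.* 𝟙 (C? u σ))
      ≡⟨ ∑-𝟙 (S n) {c = ρ} (permutations-unique n) (permutations-complete n ρ)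
           (D? w)
           (λ σ → mk⇔
             (λ s → order-reflecting⇒≈ σ ρ (λ i j σi<σj → Equivalence.from (ρ-sorts i j) (s i j σi<σj)))
             (λ σ≈ρ i j σi<σj → Equivalence.to (ρ-sorts i j) (subst₂ _<_ (σ≈ρ i) (σ≈ρ j) σi<σj)))
           (λ σ → 𝟙 (C? u σ))
           (λ {σ} σ≈ρ → 𝟙-⇔ (mk⇔ (Compatible-resp L (λ _ → refl) σ≈ρ)
                             (Compatible-resp L (λ _ → refl) (sym ∘ σ≈ρ)))
                             (C? u σ) (C? u ρ)) ⟩
    𝟙 (C? u ρ)
      ≡⟨ 𝟙-⇔ (Compatible-⋆ L M u w π ρ ρ-sorts) (C? u ρ) (E? (zipWith (place L) u w)) ⟩
    𝟙 (E? (zipWith (place L) u w)) ∎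
    where
    ρ : Permutation′ n
    ρ = proj₁ (sortingPermutation M (lookup w) π)
    ρ-sorts : ∀ i j → (ρ ⟨$⟩ʳ i < ρ ⟨$⟩ʳ j) ⇔ Precedes M (lookup w) (π ⟨$⟩ʳ_) i j
    ρ-sorts = proj₂ (sortingPermutation M (lookup w) π)

-- Alternating alphabets

alternating : Bool → Fin a → Bool
alternating s zero    = s
alternating s (suc i) = alternating (not s) i

not^ : ℕ → Bool → Bool
not^ zero    s = s
not^ (suc b) s = not^ b (not s)

not^-not : ∀ b s → not^ b (not s) ≡ not (not^ b s)
not^-not zero    s = refl
not^-not (suc b) s = not^-not b (not s)

not^-involutive : ∀ b s → not^ b (not^ b s) ≡ s
not^-involutive zero    s = refl
not^-involutive (suc b) s = begin
  not^ b (not (not^ b (not s))) ≡⟨ cong (not^ b ∘ not) (not^-not b s) ⟩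
  not^ b (not (not (not^ b s))) ≡⟨ cong (not^ b) (Bool.not-involutive _) ⟩
  not^ b (not^ b s)             ≡⟨ not^-involutive b s ⟩
  s                             ∎
  where open ≡-Reasoning

alternating-↑ˡ : ∀ s (i : Fin b) k → alternating s (i ↑ˡ k) ≡ alternating s i
alternating-↑ˡ s zero    k = refl
alternating-↑ˡ s (suc i) k = alternating-↑ˡ (not s) i k

alternating-↑ʳ : ∀ b s (i : Fin n) → alternating s (b ↑ʳ i) ≡ alternating (not^ b s) i
alternating-↑ʳ zero    s i = refl
alternating-↑ʳ (suc b) s i = alternating-↑ʳ b (not s) i

alternating-inject₁ : ∀ s (i : Fin n) → alternating s (inject₁ i) ≡ alternating s i
alternating-inject₁ s zero    = refl
alternating-inject₁ s (suc i) = alternating-inject₁ (not s) i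

alternating-fromℕ : ∀ s b → alternating s (fromℕ b) ≡ not^ b s
alternating-fromℕ s zero    = refl
alternating-fromℕ s (suc b) = alternating-fromℕ (not s) b

-- `not^ b s` is the sign that would come after the last letter, hence the negative of the last
-- sign. So the alphabet read backwards and negated alternates from it.
alternating-opposite : ∀ s (i : Fin b) → alternating (not^ b s) (opposite i) ≡ not (alternating s i)
alternating-opposite {b = suc b} s zero    =
  trans (alternating-fromℕ (not^ b (not s)) b) (not^-involutive b (not s))
alternating-opposite {b = suc b} s (suc i) =
  trans (alternating-inject₁ (not^ b (not s)) (opposite i)) (alternating-opposite (not s) i)

-- The sign with which a copy of an alternating alphabet with b letters and
-- first sign t begins over a letter of sign s.
leading : ℕ → Bool → Bool → Bool
leading b true  t = t
leading b false t = not^ b t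

not^-leading : ∀ b s t → not^ b (leading b s t) ≡ leading b (not s) t
not^-leading b true  t = refl
not^-leading b false t = not^-involutive b t

-- Successive copies are turned alternately. After the `b` letters of one copy the alternation has
-- reached exactly the first sign of the next; this is `not^-leading`.
alternating-place : ∀ s t (x : Fin a) (y : Fin b) →
  alternating (leading b s t) (place (alternating s) x y) ≡
  (if alternating s x then alternating t y else not (alternating t y))
alternating-place {a = suc a} {b} true  t zero y = alternating-↑ˡ t y (a ℕ.* b)
alternating-place {a = suc a} {b} false t zero y =
  trans (alternating-↑ˡ (not^ b t) (opposite y) (a ℕ.* b)) (alternating-opposite t y)
alternating-place {b = b} s t (suc x) y = begin
  alternating (leading b s t) (b ↑ʳ place (alternating (not s)) x y)
    ≡⟨ alternating-↑ʳ b (leading b s t) _ ⟩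
  alternating (not^ b (leading b s t)) (place (alternating (not s)) x y)
    ≡⟨ cong (λ t′ → alternating t′ (place (alternating (not s)) x y)) (not^-leading b s t) ⟩
  alternating (leading b (not s) t) (place (alternating (not s)) x y)
    ≡⟨ alternating-place (not s) t x y ⟩
  (if alternating (not s) x then alternating t y else not (alternating t y)) ∎
  where open ≡-Reasoning

alternating-⋆ : ∀ s t → alternating {a} s ⋆ alternating {b} t ≗ alternating (leading b s t)
alternating-⋆ {a} {b} s t z = begin
  (L ⋆ M) z             ≡⟨ cong (L ⋆ M) (place-unplace L z) ⟨
  (L ⋆ M) (place L x y) ≡⟨ ⋆-place L M x y ⟩
  (if L x then M y else not (M y))
                        ≡⟨ alternating-place s t x y ⟨
  LM (place L x y)      ≡⟨ cong LM (place-unplace L z) ⟩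
  LM z                  ∎
  where
  open ≡-Reasoning
  L : Fin a → Bool
  L = alternating s
  M : Fin b → Bool
  M = alternating t
  LM : Fin (a ℕ.* b) → Bool
  LM = alternating (leading b s t)
  x : Fin a
  x = proj₁ (unplace L b z)
  y : Fin b
  y = proj₂ (unplace L b z)

-- Arithmetic in the group algebra

*-cong : ∀ {x x′ y y′ : ℚ[S n ]} → x ≈ x′ → y ≈ y′ → x * y ≈ x′ * y′
*-cong {n} x≈ y≈ π = ∑-cong (permutations n) λ σ → cong₂ ℚ._*_ (x≈ σ) (y≈ (flip σ ∘ₚ π))

*-zeroˡ : ∀ (x : ℚ[S n ]) → 0# * x ≈ 0#
*-zeroˡ {n} x π = trans (∑-cong (permutations n) λ σ → ℚ.*-zeroˡ (coeff x (flip σ ∘ₚ π)))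
                        (∑-zero (permutations n))

*-zeroʳ : ∀ (x : ℚ[S n ]) → x * 0# ≈ 0#
*-zeroʳ {n} x π = trans (∑-cong (permutations n) λ σ → ℚ.*-zeroʳ (coeff x σ))
                        (∑-zero (permutations n))

*-distribʳ-+ : ∀ (x y z : ℚ[S n ]) → (x + y) * z ≈ x * z + y * z
*-distribʳ-+ {n} x y z π = trans
  (∑-cong (permutations n) λ σ → ℚ.*-distribʳ-+ (coeff z (flip σ ∘ₚ π)) (coeff x σ) (coeff y σ))
  (∑-+ (permutations n) _ _)

*-distribˡ-+ : ∀ (x y z : ℚ[S n ]) → x * (y + z) ≈ x * y + x * z
*-distribˡ-+ {n} x y z π = trans
  (∑-cong (permutations n) λ σ → ℚ.*-distribˡ-+ (coeff x σ) (coeff y _) (coeff z (flip σ ∘ₚ π)))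
  (∑-+ (permutations n) _ _)

•-*-assoc : ∀ q (x y : ℚ[S n ]) → (q • x) * y ≈ q • (x * y)
•-*-assoc {n} q x y π = trans
  (∑-cong (permutations n) λ σ → ℚ.*-assoc q (coeff x σ) (coeff y (flip σ ∘ₚ π)))
  (sym (∑-*ˡ q (permutations n) _))

*-•-comm : ∀ q (x y : ℚ[S n ]) → x * (q • y) ≈ q • (x * y)
*-•-comm {n} q x y π = trans
  (∑-cong (permutations n) λ σ → swap (coeff x σ) (coeff y (flip σ ∘ₚ π)))
  (sym (∑-*ˡ q (permutations n) _))
  where
  swap : ∀ r s → r ℚ.* (q ℚ.* s) ≡ q ℚ.* (r ℚ.* s)
  swap r s = solve 3 (λ q r s → r :* (q :* s) := q :* (r :* s)) refl q r s
    where open +-*-Solver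

-- Zigzags with both first slopes

ruffle : ℕ → ∀ n → ℚ[S n ]
ruffle a n = shuffle (alternating {a} true) n + shuffle (alternating {a} false) n

-- The products begin with the signs `true`, `false`, `not^ b true` and `not^ b false`. The last two
-- are again both signs, whatever the parity of `b`; hence the doubling.
ruffle-* : ∀ a b n → ruffle a n * ruffle b n ≈ ruffle (a ℕ.* b) n + ruffle (a ℕ.* b) n
ruffle-* a b n π = begin
  coeff ((X true + X false) * (Y true + Y false)) π
    ≡⟨ *-distribʳ-+ (X true) (X false) (Y true + Y false) π ⟩
  coeff (X true * (Y true + Y false)) π ℚ.+ coeff (X false * (Y true + Y false)) π
    ≡⟨ cong₂ ℚ._+_ (*-distribˡ-+ (X true) (Y true) (Y false) π) (*-distribˡ-+ (X false) (Y true) (Y false) π) ⟩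
  (coeff (X true * Y true) π ℚ.+ coeff (X true * Y false) π) ℚ.+
  (coeff (X false * Y true) π ℚ.+ coeff (X false * Y false) π)
    ≡⟨ cong₂ ℚ._+_ (cong₂ ℚ._+_ (product true true) (product true false))
                   (cong₂ ℚ._+_ (product false true) (product false false)) ⟩
  (Z true ℚ.+ Z false) ℚ.+ (Z (not^ b true) ℚ.+ Z (not^ b false))
    ≡⟨ cong (Z true ℚ.+ Z false ℚ.+_)
         (trans (cong (λ s → Z (not^ b true) ℚ.+ Z s) (not^-not b true)) (both (not^ b true))) ⟩
  (Z true ℚ.+ Z false) ℚ.+ (Z true ℚ.+ Z false) ∎
  where
  open ≡-Reasoning
  X Y : Bool → ℚ[S n ]
  X s = shuffle (alternating {a} s) n
  Y s = shuffle (alternating {b} s) n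
  Z : Bool → ℚ
  Z s = coeff (shuffle (alternating {a ℕ.* b} s) n) π
  product : ∀ s t → coeff (X s * Y t) π ≡ Z (leading b s t)
  product s t = trans (shuffle-* (alternating {a} s) (alternating {b} t) π)
                      (shuffle-≗ (alternating-⋆ {a} {b} s t) π)
  both : ∀ s → Z s ℚ.+ Z (not s) ≡ Z true ℚ.+ Z false
  both true  = refl
  both false = ℚ.+-comm (Z false) (Z true)

-- Counting the words compatible with a permutation

-- The lexicographic order is transitive, so only neighbouring positions need comparing.
Compatible-suc : ∀ (L : Fin a → Bool) (u : Fin (suc (suc n)) → Fin a) (x : Fin (suc (suc n)) → Fin m) →
  Compatible L u x ⇔ (Precedes L u x zero (suc zero) × Compatible L (u ∘ suc) (x ∘ suc))
Compatible-suc {n = n} L u x = mk⇔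
  (λ c → c zero (suc zero) (s≤s z≤n) , λ i j i<j → c (suc i) (suc j) (s≤s i<j))
  (uncurry extend)
  where
  extend : Precedes L u x zero (suc zero) → Compatible L (u ∘ suc) (x ∘ suc) → Compatible L u x
  extend p c zero    (suc zero)    _         = p
  extend p c zero    (suc (suc j)) _         =
    Lex-trans L {x = u zero} {u (suc zero)} {u (suc (suc j))} Fin.<-trans (λ q q′ → Fin.<-trans q′ q)
      p (c zero (suc j) (s≤s z≤n))
  extend p c (suc i) (suc j)       (s≤s i<j) = c i j i<j

-- A word may repeat a letter only if its slope agrees with the direction `d` in which the
-- permutation moves.
Step : Bool → Bool → Fin a → Fin a → Set
Step s d p q = p < q ⊎ (p ≡ q × alternating s p ≡ d)

step? : ∀ s d (p q : Fin a) → Dec (Step s d p q)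
step? s d p q = (p <? q) ⊎-dec ((p Fin.≟ q) ×-dec (alternating s p Bool.≟ d))

signed-<⇔ : ∀ s {y z : Fin m} → y ≢ z → (if s then y < z else z < y) ⇔ (s ≡ does (y <? z))
signed-<⇔ s {y} {z} y≢z with Fin.<-cmp y z
signed-<⇔ true  {y} {z} y≢z | tri< y<z _ _ = mk⇔ (λ _ → sym (dec-true (y <? z) y<z)) (λ _ → y<z)
signed-<⇔ false {y} {z} y≢z | tri< y<z _ z≮y = mk⇔ (λ z<y → contradiction z<y z≮y)
  (λ eq → contradiction (trans eq (dec-true (y <? z) y<z)) λ ())
signed-<⇔ s     {y} {z} y≢z | tri≈ _ y≡z _ = contradiction y≡z y≢z
signed-<⇔ true  {y} {z} y≢z | tri> y≮z _ z<y = mk⇔ (λ y<z → contradiction y<z y≮z)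
  (λ eq → contradiction (trans eq (dec-false (y <? z) y≮z)) λ ())
signed-<⇔ false {y} {z} y≢z | tri> y≮z _ z<y = mk⇔ (λ _ → sym (dec-false (y <? z) y≮z)) (λ _ → z<y)

Precedes⇔Step : ∀ s (u : Fin (suc (suc n)) → Fin a) (x : Fin (suc (suc n)) → Fin m) →
  x zero ≢ x (suc zero) → Precedes (alternating s) u x zero (suc zero) ⇔
  Step s (does (x zero <? x (suc zero))) (u zero) (u (suc zero))
Precedes⇔Step s u x x₀≢x₁ = mk⇔ (Sum.map₂ λ (eq , t) → eq , Equivalence.to   sign⇔ t)
                                (Sum.map₂ λ (eq , t) → eq , Equivalence.from sign⇔ t)
  where sign⇔ = signed-<⇔ (alternating s (u zero)) x₀≢x₁

-- The functions g below assign a weight to a letter of an alternating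
-- alphabet, given its sign and the number of letters above it.

above : (Bool → ℕ → ℚ) → Bool → ℕ → ℚ
above g s zero    = g s zero
above g s (suc r) = g s (suc r) ℚ.+ above g (not s) r

-- `above` adds the weights of a letter and of all letters over it. `step` adds those of the letters
-- that may follow it under a move in direction `d`: the letter itself counts only if its sign is
-- `d`.
step : (Bool → ℕ → ℚ) → Bool → Bool → ℕ → ℚ
step g d s zero    = 𝟙 (s Bool.≟ d) ℚ.* g s zero
step g d s (suc r) = 𝟙 (s Bool.≟ d) ℚ.* g s (suc r) ℚ.+ above g (not s) r

∑-alternating : ∀ g s r →
  ∑ (allFin (suc r)) (λ q → g (alternating s q) (r ℕ-ℕ q)) ≡ above g s r
∑-alternating g s zero    = ℚ.+-identityʳ (g s zero)
∑-alternating g s (suc r) = trans (∑-allFin-suc (λ q → g (alternating s q) (suc r ℕ-ℕ q)))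
  (cong (g s (suc r) ℚ.+_) (∑-alternating g (not s) r))

Step-zero : ∀ a s d → 𝟙 (step? {suc a} s d zero zero) ≡ 𝟙 (s Bool.≟ d)
Step-zero a s d = 𝟙-⇔ (mk⇔ (λ { (inj₁ ()) ; (inj₂ (_ , eq)) → eq }) (λ eq → inj₂ (refl , eq)))
  (step? {suc a} s d zero zero) (s Bool.≟ d)

∑-step : ∀ g s d r (p : Fin (suc r)) →
  ∑ (allFin (suc r)) (λ q → 𝟙 (step? s d p q) ℚ.* g (alternating s q) (r ℕ-ℕ q)) ≡
  step g d (alternating s p) (r ℕ-ℕ p)
∑-step g s d zero    zero    = trans
  (∑-allFin-suc (λ q → 𝟙 (step? s d zero q) ℚ.* g (alternating s q) (zero ℕ-ℕ q)))
  (trans (ℚ.+-identityʳ _) (cong (ℚ._* g s zero) (Step-zero zero s d)))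
∑-step g s d (suc r) zero    = trans
  (∑-allFin-suc (λ q → 𝟙 (step? s d zero q) ℚ.* g (alternating s q) (suc r ℕ-ℕ q)))
  (cong₂ ℚ._+_
    (cong (ℚ._* g s (suc r)) (Step-zero (suc r) s d))
    (trans
      (∑-cong (allFin (suc r)) λ q → trans
        (cong (ℚ._* g (alternating (not s) q) (r ℕ-ℕ q))
              (𝟙-true (step? s d zero (suc q)) (inj₁ (s≤s z≤n))))
        (ℚ.*-identityˡ (g (alternating (not s) q) (r ℕ-ℕ q))))
      (∑-alternating g (not s) r)))
∑-step g s d (suc r) (suc p) = trans
  (∑-allFin-suc (λ q → 𝟙 (step? s d (suc p) q) ℚ.* g (alternating s q) (suc r ℕ-ℕ q)))
  (trans
    (cong₂ ℚ._+_
      (trans (cong (ℚ._* g s (suc r)) (𝟙-false (step? s d (suc p) zero) λ { (inj₁ ()) ; (inj₂ ()) }))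
             (ℚ.*-zeroˡ (g s (suc r))))
      (trans
        (∑-cong (allFin (suc r)) λ q → cong (ℚ._* g (alternating (not s) q) (r ℕ-ℕ q))
          (𝟙-⇔ (Step-suc q) (step? s d (suc p) (suc q)) (step? (not s) d p q)))
        (∑-step g (not s) d r p)))
    (ℚ.+-identityˡ _))
  where
  Step-suc : ∀ q → Step s d (suc p) (suc q) ⇔ Step (not s) d p q
  Step-suc q = mk⇔
    (λ { (inj₁ (s≤s p<q)) → inj₁ p<q ; (inj₂ (refl , eq)) → inj₂ (refl , eq) })
    (λ { (inj₁ p<q) → inj₁ (s≤s p<q) ; (inj₂ (refl , eq)) → inj₂ (refl , eq) })

-- A transfer-matrix count: the number of ways to continue a word through the moves `ds` from a
-- letter of sign `s` with `r` letters above it.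
weight : List Bool → Bool → ℕ → ℚ
weight []       s r = 1ℚ
weight (d ∷ ds) = step (weight ds) d

ascents : (Fin (suc n) → Fin m) → List Bool
ascents {n = zero}  x = []
ascents {n = suc n} x = does (x zero <? x (suc zero)) ∷ ascents (x ∘ suc)

suc-injective⁺ : ∀ {x : Fin (suc n) → Fin m} → Injective _≡_ _≡_ x → Injective _≡_ _≡_ (x ∘ suc)
suc-injective⁺ x-inj eq = Fin.suc-injective (x-inj eq)

∑-compatible-∷ : ∀ s r n (x : Fin (suc n) → Fin m) → Injective _≡_ _≡_ x → ∀ p →
  ∑ (words (suc r) n) (λ w → 𝟙 (compatible? (alternating s) (lookup (p ∷ w)) x)) ≡
  weight (ascents x) (alternating s p) (r ℕ-ℕ p)
∑-compatible-∷ s r zero x x-inj p = trans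
  (ℚ.+-identityʳ (𝟙 (compatible? (alternating s) (lookup (p ∷ [])) x)))
  (𝟙-true (compatible? (alternating s) (lookup (p ∷ [])) x) λ { zero zero () })
∑-compatible-∷ {m = m} s r (suc n) x x-inj p = begin
  ∑ (words (suc r) (suc n)) (λ w → 𝟙 (C? (p ∷ w) x))
    ≡⟨ ∑-words-suc (suc r) n (λ w → 𝟙 (C? (p ∷ w) x)) ⟩
  ∑ (allFin (suc r)) (λ q → ∑ (words (suc r) n) (λ w → 𝟙 (C? (p ∷ q ∷ w) x)))
    ≡⟨ ∑-cong (allFin (suc r)) (λ q → ∑-cong (words (suc r) n) (λ w → split q w)) ⟩
  ∑ (allFin (suc r)) (λ q → ∑ (words (suc r) n) (λ w → 𝟙 (step? s d p q) ℚ.* 𝟙 (C? (q ∷ w) (x ∘ suc))))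
    ≡⟨ ∑-cong (allFin (suc r)) (λ q → ∑-*ˡ (𝟙 (step? s d p q)) (words (suc r) n) (λ w → 𝟙 (C? (q ∷ w) (x ∘ suc)))) ⟨
  ∑ (allFin (suc r)) (λ q → 𝟙 (step? s d p q) ℚ.* ∑ (words (suc r) n) (λ w → 𝟙 (C? (q ∷ w) (x ∘ suc))))
    ≡⟨ ∑-cong (allFin (suc r)) (λ q → cong (𝟙 (step? s d p q) ℚ.*_)
         (∑-compatible-∷ s r n (x ∘ suc) (suc-injective⁺ x-inj) q)) ⟩
  ∑ (allFin (suc r)) (λ q → 𝟙 (step? s d p q) ℚ.* weight (ascents (x ∘ suc)) (alternating s q) (r ℕ-ℕ q))
    ≡⟨ ∑-step (weight (ascents (x ∘ suc))) s d r p ⟩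
  step (weight (ascents (x ∘ suc))) d (alternating s p) (r ℕ-ℕ p) ∎
  where
  open ≡-Reasoning
  d : Bool
  d = does (x zero <? x (suc zero))
  C? : ∀ {n} (w : Vec (Fin (suc r)) n) (x : Fin n → Fin m) → Dec (Compatible (alternating s) (lookup w) x)
  C? w x = compatible? (alternating s) (lookup w) x
  x₀≢x₁ : x zero ≢ x (suc zero)
  x₀≢x₁ eq with () ← x-inj eq
  split : ∀ q w → 𝟙 (C? (p ∷ q ∷ w) x) ≡ 𝟙 (step? s d p q) ℚ.* 𝟙 (C? (q ∷ w) (x ∘ suc))
  split q w = trans
    (𝟙-⇔ (mk⇔
        (λ c → let (e , c′) = Equivalence.to (Compatible-suc (alternating s) (lookup (p ∷ q ∷ w)) x) c in
               Equivalence.to (Precedes⇔Step s (lookup (p ∷ q ∷ w)) x x₀≢x₁) e , c′)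
        (λ (e , c′) → Equivalence.from (Compatible-suc (alternating s) (lookup (p ∷ q ∷ w)) x)
               (Equivalence.from (Precedes⇔Step s (lookup (p ∷ q ∷ w)) x x₀≢x₁) e , c′)))
      (C? (p ∷ q ∷ w) x) (step? s d p q ×-dec C? (q ∷ w) (x ∘ suc)))
    (𝟙-× (step? s d p q) (C? (q ∷ w) (x ∘ suc)))

shuffle-weight : ∀ s r (σ : Permutation′ (suc n)) →
  coeff (shuffle (alternating {suc r} s) (suc n)) σ ≡ above (weight (ascents (σ ⟨$⟩ʳ_))) s r
shuffle-weight {n} s r σ = begin
  ∑ (words (suc r) (suc n)) (λ w → 𝟙 (compatible? (alternating s) (lookup w) (σ ⟨$⟩ʳ_)))
    ≡⟨ ∑-words-suc (suc r) n (λ w → 𝟙 (compatible? (alternating s) (lookup w) (σ ⟨$⟩ʳ_))) ⟩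
  ∑ (allFin (suc r)) (λ p → ∑ (words (suc r) n) (λ w →
    𝟙 (compatible? (alternating s) (lookup (p ∷ w)) (σ ⟨$⟩ʳ_))))
    ≡⟨ ∑-cong (allFin (suc r)) (∑-compatible-∷ s r n (σ ⟨$⟩ʳ_) (⟨$⟩ʳ-injective σ)) ⟩
  ∑ (allFin (suc r)) (λ p → weight (ascents (σ ⟨$⟩ʳ_)) (alternating s p) (r ℕ-ℕ p))
    ≡⟨ ∑-alternating (weight (ascents (σ ⟨$⟩ʳ_))) s r ⟩
  above (weight (ascents (σ ⟨$⟩ʳ_))) s r ∎
  where open ≡-Reasoning

-- Alternating alphabets only see the turning points

-- On generating functions in r these are multiplication by (1 + x²) / (1 − x²)
-- and by 2x / (1 − x²), so they commute.
stay switch : (ℕ → ℚ) → ℕ → ℚ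
stay h zero          = h zero
stay h (suc zero)    = h (suc zero)
stay h (suc (suc r)) = h (suc (suc r)) ℚ.+ (h r ℚ.+ stay h r)
switch h zero          = 0ℚ
switch h (suc zero)    = h zero ℚ.+ h zero
switch h (suc (suc r)) = h (suc r) ℚ.+ (h (suc r) ℚ.+ switch h r)

pass : Bool → (ℕ → ℚ) → ℕ → ℚ
pass false = stay
pass true  = switch

stay-cong : ∀ {h h′} → h ≗ h′ → stay h ≗ stay h′
stay-cong h≗ zero          = h≗ zero
stay-cong h≗ (suc zero)    = h≗ (suc zero)
stay-cong h≗ (suc (suc r)) = cong₂ ℚ._+_ (h≗ (suc (suc r))) (cong₂ ℚ._+_ (h≗ r) (stay-cong h≗ r))

switch-cong : ∀ {h h′} → h ≗ h′ → switch h ≗ switch h′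
switch-cong h≗ zero          = refl
switch-cong h≗ (suc zero)    = cong₂ ℚ._+_ (h≗ zero) (h≗ zero)
switch-cong h≗ (suc (suc r)) =
  cong₂ ℚ._+_ (h≗ (suc r)) (cong₂ ℚ._+_ (h≗ (suc r)) (switch-cong h≗ r))

pass-cong : ∀ c {h h′} → h ≗ h′ → pass c h ≗ pass c h′
pass-cong false = stay-cong
pass-cong true  = switch-cong

-- In generating functions, (1 + x²) / (1 - x²) = 1 + x · 2x / (1 - x²).
stay-suc : ∀ h r → stay h (suc r) ≡ h (suc r) ℚ.+ switch h r
stay-suc h zero          = sym (ℚ.+-identityʳ (h 1))
stay-suc h (suc zero)    = refl
stay-suc h (suc (suc r)) = cong (λ z → h (suc (suc (suc r))) ℚ.+ (h (suc r) ℚ.+ z)) (stay-suc h r)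

switch-stay : ∀ h → switch (stay h) ≗ stay (switch h)
switch-stay h zero          = refl
switch-stay h (suc zero)    = refl
switch-stay h (suc (suc r)) = begin
  stay h (suc r) ℚ.+ (stay h (suc r) ℚ.+ switch (stay h) r)
    ≡⟨ cong₂ (λ y z → y ℚ.+ (y ℚ.+ z)) (stay-suc h r) (switch-stay h r) ⟩
  (h (suc r) ℚ.+ switch h r) ℚ.+ ((h (suc r) ℚ.+ switch h r) ℚ.+ stay (switch h) r)
    ≡⟨ rearrange (h (suc r)) (switch h r) (stay (switch h) r) ⟩
  (h (suc r) ℚ.+ (h (suc r) ℚ.+ switch h r)) ℚ.+ (switch h r ℚ.+ stay (switch h) r) ∎
  where
  open ≡-Reasoning
  rearrange : ∀ p q t → (p ℚ.+ q) ℚ.+ ((p ℚ.+ q) ℚ.+ t) ≡ (p ℚ.+ (p ℚ.+ q)) ℚ.+ (q ℚ.+ t)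
  rearrange = solve 3 (λ p q t → (p :+ q) :+ ((p :+ q) :+ t) := (p :+ (p :+ q)) :+ (q :+ t)) refl
    where open +-*-Solver

step-same : ∀ g d r → step g d d r ≡ above g d r
step-same g d zero    =
  trans (cong (ℚ._* g d zero) (𝟙-true (d Bool.≟ d) refl)) (ℚ.*-identityˡ (g d zero))
step-same g d (suc r) = cong (ℚ._+ above g (not d) r)
  (trans (cong (ℚ._* g d (suc r)) (𝟙-true (d Bool.≟ d) refl)) (ℚ.*-identityˡ (g d (suc r))))

not≢ : ∀ d → not d ≢ d
not≢ true  ()
not≢ false ()

step-not-zero : ∀ g d → step g d (not d) zero ≡ 0ℚ
step-not-zero g d = trans
  (cong (ℚ._* g (not d) zero) (𝟙-false (not d Bool.≟ d) (not≢ d))) (ℚ.*-zeroˡ (g (not d) zero))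

step-not-suc : ∀ g d r → step g d (not d) (suc r) ≡ above g d r
step-not-suc g d r = trans
  (cong₂ ℚ._+_
    (trans (cong (ℚ._* g (not d) (suc r)) (𝟙-false (not d Bool.≟ d) (not≢ d)))
           (ℚ.*-zeroˡ (g (not d) (suc r))))
    (cong (λ s → above g s r) (Bool.not-involutive d)))
  (ℚ.+-identityˡ (above g d r))

-- A letter of sign `d` with `r` letters above it and the letter of opposite sign just below it both
-- contribute `above g d r`; a topmost letter of opposite sign contributes 0. The terms therefore
-- come in equal pairs, except that the lowest letter, being of sign `d`, stands alone. In
-- `above-step-not` the lowest letter opens a pair instead.
above-step-same : ∀ g d → above (step g d) d ≗ stay (above g d)
above-step-same g d zero          = step-same g d zero
above-step-same g d (suc zero)    = trans
  (cong₂ ℚ._+_ (step-same g d 1) (step-not-zero g d)) (ℚ.+-identityʳ (above g d 1))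
above-step-same g d (suc (suc r)) = cong₂ ℚ._+_ (step-same g d (suc (suc r)))
  (cong₂ ℚ._+_ (step-not-suc g d r)
    (trans (cong (λ s → above (step g d) s r) (Bool.not-involutive d)) (above-step-same g d r)))

above-step-not : ∀ g d → above (step g d) (not d) ≗ switch (above g d)
above-step-not g d zero          = step-not-zero g d
above-step-not g d (suc zero)    = cong₂ ℚ._+_ (step-not-suc g d 0)
  (trans (cong (λ s → step g d s 0) (Bool.not-involutive d)) (step-same g d 0))
above-step-not g d (suc (suc r)) = cong₂ ℚ._+_ (step-not-suc g d (suc r))
  (cong₂ ℚ._+_
    (trans (cong (λ s → step g d s (suc r)) (Bool.not-involutive d)) (step-same g d (suc r)))
    (trans (cong (λ s → above (step g d) s r) (Bool.not-involutive (not d))) (above-step-not g d r)))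

above-step : ∀ g s d → above (step g d) s ≗ pass (s xor d) (above g d)
above-step g true  true  = above-step-same g true
above-step g true  false = above-step-not g false
above-step g false true  = above-step-not g true
above-step g false false = above-step-same g false

1+_ : ℕ → ℚ
1+ zero  = 1ℚ
1+ suc r = 1ℚ ℚ.+ 1+ r

changes : Bool → List Bool → List Bool
changes s []       = []
changes s (d ∷ ds) = (s xor d) ∷ changes d ds

above-weight : ∀ s ds → above (weight ds) s ≗ foldr pass 1+_ (changes s ds)
above-weight s []       zero    = refl
above-weight s []       (suc r) = cong (1ℚ ℚ.+_) (above-weight (not s) [] r)
above-weight s (d ∷ ds) r       = trans (above-step (weight ds) s d r)
  (pass-cong (s xor d) (above-weight d ds) r)

-- The normal form after commuting the operators. As `1+_` has generating function 1 / (1 - x)²,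
-- that of `profile z k` is (1 + x²)^z (2x)^k / ((1 - x²)^(z+k) (1 - x)²).
profile : ℕ → ℕ → ℕ → ℚ
profile zero    zero    = 1+_
profile zero    (suc k) = switch (profile zero k)
profile (suc z) k       = stay (profile z k)

switch-profile : ∀ z k → switch (profile z k) ≗ profile z (suc k)
switch-profile zero    k r = refl
switch-profile (suc z) k r =
  trans (switch-stay (profile z k) r) (stay-cong (switch-profile z k) r)

trues falses : List Bool → ℕ
trues []           = 0
trues (true  ∷ cs) = suc (trues cs)
trues (false ∷ cs) = trues cs
falses []           = 0
falses (true  ∷ cs) = falses cs
falses (false ∷ cs) = suc (falses cs)

foldr-pass : ∀ cs → foldr pass 1+_ cs ≗ profile (falses cs) (trues cs)
foldr-pass []           r = refl
foldr-pass (true  ∷ cs) r =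
  trans (switch-cong (foldr-pass cs) r) (switch-profile (falses cs) (trues cs) r)
foldr-pass (false ∷ cs) r = stay-cong (foldr-pass cs) r

falses≡length∸trues : ∀ cs → falses cs ≡ length cs ∸ trues cs
falses≡length∸trues cs = sym (trans (cong (_∸ trues cs) (sym (falses+trues cs))) (ℕ.m+n∸n≡m (falses cs) (trues cs)))
  where
  falses+trues : ∀ cs → falses cs ℕ.+ trues cs ≡ length cs
  falses+trues []           = refl
  falses+trues (true  ∷ cs) = trans (ℕ.+-suc (falses cs) (trues cs)) (cong suc (falses+trues cs))
  falses+trues (false ∷ cs) = cong suc (falses+trues cs)

length-changes : ∀ s ds → length (changes s ds) ≡ length ds
length-changes s []       = refl
length-changes s (d ∷ ds) = cong suc (length-changes d ds)

length-ascents : ∀ (x : Fin (suc n) → Fin m) → length (ascents x) ≡ n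
length-ascents {n = zero}  x = refl
length-ascents {n = suc n} x = cong suc (length-ascents (x ∘ suc))

-- ruffleCoeff n r k is the coefficient in ruffle (r + 1) of the permutations of n + 1
-- letters with k turning points.
ruffleCoeff : ℕ → ℕ → ℕ → ℚ
ruffleCoeff zero    r k = profile zero k r ℚ.+ profile zero k r
ruffleCoeff (suc m) r k = profile (suc (m ∸ k)) k r ℚ.+ profile (m ∸ k) (suc k) r

ascent : (Fin (suc (suc n)) → Fin m) → Bool
ascent x = does (x zero <? x (suc zero))

turns : (Fin (suc (suc n)) → Fin m) → List Bool
turns x = changes (ascent x) (ascents (x ∘ suc))

-- The first slope that agrees with the first move enters through `stay`, the other through
-- `switch`. Each occurs once in the sum, so the direction of that move drops out.
ruffle-turns : ∀ r (σ : Permutation′ (suc (suc m))) →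
               coeff (ruffle (suc r) (suc (suc m))) σ ≡ ruffleCoeff (suc m) r (trues (turns (σ ⟨$⟩ʳ_)))
ruffle-turns {m} r σ = begin
  coeff (ruffle (suc r) (suc (suc m))) σ
    ≡⟨ cong₂ ℚ._+_ (shuffle-weight true r σ) (shuffle-weight false r σ) ⟩
  above (weight (d ∷ ds)) true r ℚ.+ above (weight (d ∷ ds)) false r
    ≡⟨ either (λ s → above (weight (d ∷ ds)) s r) d ⟩
  above (weight (d ∷ ds)) d r ℚ.+ above (weight (d ∷ ds)) (not d) r
    ≡⟨ cong₂ ℚ._+_
         (trans (above-step-same (weight ds) d r) (stay-cong profiled r))
         (trans (above-step-not (weight ds) d r)
           (trans (switch-cong profiled r) (switch-profile (m ∸ k) k r))) ⟩
  ruffleCoeff (suc m) r k ∎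
  where
  open ≡-Reasoning
  d : Bool
  d = ascent (σ ⟨$⟩ʳ_)
  ds : List Bool
  ds = ascents (λ i → σ ⟨$⟩ʳ suc i)
  k : ℕ
  k = trues (changes d ds)
  either : ∀ (f : Bool → ℚ) d → f true ℚ.+ f false ≡ f d ℚ.+ f (not d)
  either f true  = refl
  either f false = ℚ.+-comm (f true) (f false)
  falses≡ : falses (changes d ds) ≡ m ∸ k
  falses≡ = trans (falses≡length∸trues (changes d ds))
    (cong (_∸ k) (trans (length-changes d ds) (length-ascents (λ i → σ ⟨$⟩ʳ suc i))))
  profiled : above (weight ds) d ≗ profile (m ∸ k) k
  profiled r = trans (above-weight d ds r)
    (trans (foldr-pass (changes d ds) r) (cong (λ z → profile z k r) falses≡))

-- Triangularity

infix 4 _LeadsAt_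

-- As a power series, `h` has order `k` and a positive leading coefficient.
_LeadsAt_ : (ℕ → ℚ) → ℕ → Set
h LeadsAt k = (∀ r → r ℕ.< k → h r ≡ 0ℚ) × ℚ.Positive (h k)

vanish-+ : ∀ {q q′} → q ≡ 0ℚ → q′ ≡ 0ℚ → q ℚ.+ q′ ≡ 0ℚ
vanish-+ refl refl = refl

positive-+-0 : ∀ q {q′} → ℚ.Positive q → q′ ≡ 0ℚ → ℚ.Positive (q ℚ.+ q′)
positive-+-0 q q>0 refl = subst ℚ.Positive (sym (ℚ.+-identityʳ q)) q>0

stay-low : ∀ {h k} → (∀ r → r ℕ.< k → h r ≡ 0ℚ) → ∀ r → r ℕ.< k → stay h r ≡ 0ℚ
stay-low low zero          r<k = low zero r<k
stay-low low (suc zero)    r<k = low 1 r<k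
stay-low low (suc (suc r)) r<k = vanish-+ (low _ r<k) (vanish-+ (low r r<k′) (stay-low low r r<k′))
  where r<k′ = ℕ.≤-trans (ℕ.m≤n+m (suc r) 2) r<k

switch-low : ∀ {h k} → (∀ r → r ℕ.< k → h r ≡ 0ℚ) → ∀ r → r ℕ.< suc k → switch h r ≡ 0ℚ
switch-low low zero          r<k       = refl
switch-low low (suc zero)    (s≤s 0<k) = vanish-+ (low 0 0<k) (low 0 0<k)
switch-low low (suc (suc r)) (s≤s r<k) = vanish-+ (low (suc r) r<k)
  (vanish-+ (low (suc r) r<k) (switch-low low r (s≤s (ℕ.≤-trans (ℕ.m≤n+m r 2) r<k))))

stay-leads : ∀ {h k} → h LeadsAt k → stay h LeadsAt k
stay-leads {h} {k} (low , lead) = stay-low low , stay-lead k low lead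
  where
  stay-lead : ∀ k → (∀ r → r ℕ.< k → h r ≡ 0ℚ) → ℚ.Positive (h k) → ℚ.Positive (stay h k)
  stay-lead zero          low lead = lead
  stay-lead (suc zero)    low lead = lead
  stay-lead (suc (suc k)) low lead = positive-+-0 (h (suc (suc k))) lead (vanish-+ (low k k<) (stay-low low k k<))
    where k< = ℕ.m≤n+m (suc k) 1

switch-leads : ∀ {h k} → h LeadsAt k → switch h LeadsAt suc k
switch-leads {h} {k} (low , lead) = switch-low low , switch-lead k low lead
  where
  switch-lead : ∀ k → (∀ r → r ℕ.< k → h r ≡ 0ℚ) → ℚ.Positive (h k) → ℚ.Positive (switch h (suc k))
  switch-lead zero    low lead = ℚ.pos+pos⇒pos (h 0) {{lead}} (h 0) {{lead}}
  switch-lead (suc k) low lead =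
    ℚ.pos+pos⇒pos (h (suc k)) {{lead}} (h (suc k) ℚ.+ switch h k)
      {{positive-+-0 (h (suc k)) lead (switch-low low k (ℕ.m≤n+m (suc k) 1))}}

profile-leads : ∀ z k → profile z k LeadsAt k
profile-leads zero    zero    = (λ _ ()) , _
profile-leads zero    (suc k) = switch-leads (profile-leads zero k)
profile-leads (suc z) k       = stay-leads (profile-leads z k)

-- This has to hold at every `k`, attained or not, for the elimination in `span-below`; it is why
-- `ruffleCoeff zero` involves `profile zero k` although a single letter has no turning points.
ruffleCoeff-low : ∀ n {r k} → r ℕ.< k → ruffleCoeff n r k ≡ 0ℚ
ruffleCoeff-low zero    {r} {k} r<k =
  vanish-+ (proj₁ (profile-leads zero k) r r<k) (proj₁ (profile-leads zero k) r r<k)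
ruffleCoeff-low (suc m) {r} {k} r<k =
  vanish-+ (proj₁ (profile-leads (suc (m ∸ k)) k) r r<k)
           (proj₁ (profile-leads (m ∸ k) (suc k)) r (ℕ.m<n⇒m<1+n r<k))

-- For at least two letters the summand with the extra `switch` has order `suc k`, so only the one
-- with the extra `stay` contributes at `k`.
ruffleCoeff-lead : ∀ n k → ℚ.Positive (ruffleCoeff n k k)
ruffleCoeff-lead zero    k = ℚ.pos+pos⇒pos (profile zero k k) {{lead}} (profile zero k k) {{lead}}
  where lead = proj₂ (profile-leads zero k)
ruffleCoeff-lead (suc m) k = positive-+-0 (profile (suc (m ∸ k)) k k)
  (proj₂ (profile-leads (suc (m ∸ k)) k))
  (proj₁ (profile-leads (m ∸ k) (suc k)) k (ℕ.n<1+n k))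

-- The reduced turning number

length-filter-map : ∀ {P : B → Set} (P? : ∀ y → Dec (P y)) (f : A → B) xs →
                    length (filter P? (map f xs)) ≡ length (filter (P? ∘ f) xs)
length-filter-map P? f []       = refl
length-filter-map P? f (x ∷ xs) with does (P? (f x))
... | true  = cong suc (length-filter-map P? f xs)
... | false = length-filter-map P? f xs

difference>0 : ∀ {i j : Fin m} → i < j → ℤ.+ toℕ j ℤ.- ℤ.+ toℕ i ℤ.> ℤ.0ℤ
difference>0 i<j = ℤ.≰⇒> λ d≤0 → ℤ.<⇒≱ (ℤ.+<+ i<j) (ℤ.i-j≤0⇒i≤j d≤0)

difference<0 : ∀ {i j : Fin m} → j < i → ℤ.+ toℕ j ℤ.- ℤ.+ toℕ i ℤ.< ℤ.0ℤ
difference<0 j<i = ℤ.≰⇒> λ d≥0 → ℤ.<⇒≱ (ℤ.+<+ j<i) (ℤ.0≤i-j⇒j≤i d≥0)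

does-oppositeSigns : ∀ {i j k : Fin m} → i ≢ j → j ≢ k →
  does (oppositeSigns? (ℤ.+ toℕ j ℤ.- ℤ.+ toℕ i) (ℤ.+ toℕ k ℤ.- ℤ.+ toℕ j)) ≡
  (does (i <? j) xor does (j <? k))
does-oppositeSigns {i = i} {j} {k} i≢j j≢k with Fin.<-cmp i j | Fin.<-cmp j k
... | tri≈ _ i≡j _ | _            = contradiction i≡j i≢j
... | _            | tri≈ _ j≡k _ = contradiction j≡k j≢k
... | tri< i<j _ _ | tri< j<k _ _
  rewrite dec-true (i <? j) i<j | dec-true (j <? k) j<k = dec-false (oppositeSigns? _ _)
  λ { (inj₁ (_ , y<0)) → ℤ.<-asym y<0 (difference>0 j<k)
    ; (inj₂ (x<0 , _)) → ℤ.<-asym x<0 (difference>0 i<j) }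
... | tri< i<j _ _ | tri> j≮k _ k<j
  rewrite dec-true (i <? j) i<j | dec-false (j <? k) j≮k = dec-true (oppositeSigns? _ _)
  (inj₁ (difference>0 i<j , difference<0 k<j))
... | tri> i≮j _ j<i | tri< j<k _ _
  rewrite dec-false (i <? j) i≮j | dec-true (j <? k) j<k = dec-true (oppositeSigns? _ _)
  (inj₂ (difference<0 j<i , difference>0 j<k))
... | tri> i≮j _ j<i | tri> j≮k _ k<j
  rewrite dec-false (i <? j) i≮j | dec-false (j <? k) j≮k = dec-false (oppositeSigns? _ _)
  λ { (inj₁ (x>0 , _)) → ℤ.<-asym x>0 (difference<0 j<i)
    ; (inj₂ (_ , y>0)) → ℤ.<-asym y>0 (difference<0 k<j) }

OppositeSteps : (Fin (suc (suc m)) → Fin n) → Fin m → Set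
OppositeSteps x j = OppositeSigns
  (ℤ.+ toℕ (x (inject₁ (suc j))) ℤ.- ℤ.+ toℕ (x (inject₁ (inject₁ j))))
  (ℤ.+ toℕ (x (suc (suc j))) ℤ.- ℤ.+ toℕ (x (inject₁ (suc j))))

oppositeSteps? : ∀ (x : Fin (suc (suc m)) → Fin n) j → Dec (OppositeSteps x j)
oppositeSteps? x j = oppositeSigns? _ _

length-turns : ∀ (x : Fin (suc (suc m)) → Fin n) → Injective _≡_ _≡_ x →
               length (filter (oppositeSteps? x) (allFin m)) ≡ trues (turns x)
length-turns {m = zero}  x x-inj = refl
length-turns {m = suc m} x x-inj = begin
  length (filter (oppositeSteps? x) (zero ∷ tabulate suc))
    ≡⟨ cong (λ js → length (filter (oppositeSteps? x) (zero ∷ js))) (map-tabulate id suc) ⟨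
  length (filter (oppositeSteps? x) (zero ∷ map suc (allFin m)))
    ≡⟨ filter-∷ (does-oppositeSigns x₀≢x₁ x₁≢x₂) ⟩
  trues ((ascent x xor ascent (x ∘ suc)) ∷ turns (x ∘ suc)) ∎
  where
  open ≡-Reasoning
  x₀≢x₁ : x zero ≢ x (suc zero)
  x₀≢x₁ eq with () ← x-inj eq
  x₁≢x₂ : x (suc zero) ≢ x (suc (suc zero))
  x₁≢x₂ eq with () ← x-inj eq
  tail : length (filter (oppositeSteps? x) (map suc (allFin m))) ≡ trues (turns (x ∘ suc))
  tail = trans (length-filter-map (oppositeSteps? x) suc (allFin m))
               (length-turns (x ∘ suc) (suc-injective⁺ x-inj))
  filter-∷ : ∀ {c} → does (oppositeSteps? x zero) ≡ c →
             length (filter (oppositeSteps? x) (zero ∷ map suc (allFin m))) ≡ trues (c ∷ turns (x ∘ suc))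
  filter-∷ {true}  eq rewrite eq = cong suc tail
  filter-∷ {false} eq rewrite eq = tail

ruffle-coeff : ∀ n r (σ : Permutation′ (suc n)) →
               coeff (ruffle (suc r) (suc n)) σ ≡ ruffleCoeff n r (reducedTurningNumber σ)
ruffle-coeff zero    r σ = trans
  (cong₂ ℚ._+_ (shuffle-weight true r σ) (shuffle-weight false r σ))
  (cong₂ ℚ._+_ (above-weight true [] r) (above-weight false [] r))
ruffle-coeff (suc m) r σ = trans (ruffle-turns r σ)
  (cong (ruffleCoeff (suc m) r) (sym (length-turns (σ ⟨$⟩ʳ_) (⟨$⟩ʳ-injective σ))))

-- Functions of a statistic on permutations

coeff-sum : ∀ (xs : List A) (v : A → ℚ[S n ]) σ → coeff (sum (map v xs)) σ ≡ ∑ xs (λ x → coeff (v x) σ)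
coeff-sum []       v σ = refl
coeff-sum (x ∷ xs) v σ = cong (coeff (v x) σ ℚ.+_) (coeff-sum xs v σ)

∑-filter : ∀ {P : A → Set} (P? : ∀ x → Dec (P x)) xs (f : A → ℚ) →
           ∑ (filter P? xs) f ≡ ∑ xs (λ x → 𝟙 (P? x) ℚ.* f x)
∑-filter P? []       f = refl
∑-filter P? (x ∷ xs) f with does (P? x)
... | true  = cong₂ ℚ._+_ (sym (ℚ.*-identityˡ (f x))) (∑-filter P? xs f)
... | false = trans (∑-filter P? xs f)
  (trans (sym (ℚ.+-identityˡ _)) (cong (ℚ._+ _) (sym (ℚ.*-zeroˡ (f x)))))

-- The span of the class sums, in a form that can be checked coefficient by coefficient. At values
-- that `t` does not attain, `function` is arbitrary.
record FunctionOf (t : Permutation′ n → ℕ) (a : ℚ[S n ]) : Set where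
  constructor _,_
  field
    function : ℕ → ℚ
    coeff-≡  : ∀ σ → coeff a σ ≡ function (t σ)

module _ {t : Permutation′ n → ℕ} where

  FunctionOf-resp : ∀ {a b} → a ≈ b → a ∈ FunctionOf t → b ∈ FunctionOf t
  FunctionOf-resp a≈b (f , a≡f) = f , λ σ → trans (sym (a≈b σ)) (a≡f σ)

  FunctionOf-0 : 0# ∈ FunctionOf t
  FunctionOf-0 = (λ _ → 0ℚ) , λ _ → refl

  FunctionOf-+ : ∀ {a b} → a ∈ FunctionOf t → b ∈ FunctionOf t → a + b ∈ FunctionOf t
  FunctionOf-+ (f , a≡f) (g , b≡g) = (λ k → f k ℚ.+ g k) , λ σ → cong₂ ℚ._+_ (a≡f σ) (b≡g σ)

  FunctionOf-• : ∀ q {a} → a ∈ FunctionOf t → q • a ∈ FunctionOf t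
  FunctionOf-• q (f , a≡f) = (λ k → q ℚ.* f k) , λ σ → cong (q ℚ.*_) (a≡f σ)

module _ (t : Permutation′ n → ℕ) (t-cong : ∀ {σ τ} → σ Perm.≈ τ → t σ ≡ t τ) where

  coeff-classSum : ∀ k σ → coeff (classSum t k) σ ≡ 𝟙 (t σ ℕ.≟ k)
  coeff-classSum k σ = begin
    coeff (sum (map ⟦_⟧ (filter t≟k (permutations n)))) σ
      ≡⟨ coeff-sum (filter t≟k (permutations n)) ⟦_⟧ σ ⟩
    ∑ (filter t≟k (permutations n)) (λ τ → 𝟙 (τ ≈ₚ? σ))
      ≡⟨ ∑-filter t≟k (permutations n) (λ τ → 𝟙 (τ ≈ₚ? σ)) ⟩
    ∑ (permutations n) (λ τ → 𝟙 (t≟k τ) ℚ.* 𝟙 (τ ≈ₚ? σ))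
      ≡⟨ ∑-cong (permutations n) (λ τ → ℚ.*-comm (𝟙 (t≟k τ)) (𝟙 (τ ≈ₚ? σ))) ⟩
    ∑ (permutations n) (λ τ → 𝟙 (τ ≈ₚ? σ) ℚ.* 𝟙 (t≟k τ))
      ≡⟨ ∑-𝟙 (S n) {c = σ} (permutations-unique n) (permutations-complete n σ)
           (_≈ₚ? σ) (λ _ → mk⇔ id id) (λ τ → 𝟙 (t≟k τ))
           (λ {τ} τ≈σ → cong (λ j → 𝟙 (j ℕ.≟ k)) (t-cong {τ} {σ} τ≈σ)) ⟩
    𝟙 (t σ ℕ.≟ k) ∎
    where
    open ≡-Reasoning
    t≟k : ∀ τ → Dec (t τ ≡ k)
    t≟k τ = t τ ℕ.≟ k

  coeff-linearCombination : ∀ c ks → Unique ks → ∀ σ → t σ ∈ˡ ks →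
    coeff (linearCombination c (classSum t) ks) σ ≡ c (t σ)
  coeff-linearCombination c ks ks! σ tσ∈ks = begin
    coeff (linearCombination c (classSum t) ks) σ
      ≡⟨ coeff-sum ks (λ k → c k • classSum t k) σ ⟩
    ∑ ks (λ k → c k ℚ.* coeff (classSum t k) σ)
      ≡⟨ ∑-cong ks (λ k → trans (cong (c k ℚ.*_) (coeff-classSum k σ)) (ℚ.*-comm (c k) (𝟙 (t σ ℕ.≟ k)))) ⟩
    ∑ ks (λ k → 𝟙 (t σ ℕ.≟ k) ℚ.* c k)
      ≡⟨ ∑-𝟙 (≡-setoid ℕ) ks! tσ∈ks (t σ ℕ.≟_) (λ _ → mk⇔ sym sym) c (cong c) ⟩
    c (t σ) ∎
    where open ≡-Reasoning

  -- The class sums are the indicators of the fibres of `t`. Evaluation on a fibre reads off its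
  -- coordinate, and the function underlying an element lists its coordinates.
  classSum-basis : IsBasis (FunctionOf t) (Attained t) (classSum t)
  classSum-basis = record
    { members     = λ {k} _ → (λ j → 𝟙 (j ℕ.≟ k)) , coeff-classSum k
    ; independent = λ ks ks! attained c c≈0 → All.tabulate λ {k} k∈ks →
        let (σ , tσ≡k) = All.lookup attained k∈ks in
        subst (λ j → c j ≡ 0ℚ) tσ≡k
          (trans (sym (coeff-linearCombination c ks ks! σ (subst (_∈ˡ ks) (sym tσ≡k) k∈ks))) (c≈0 σ))
    ; spanning    = λ (f , a≡f) → values , f , All.tabulate value-attained ,
        λ σ → trans (a≡f σ) (sym (coeff-linearCombination f values
          (deduplicate-! ℕ._≟_ (map t (permutations n))) σ (value∈ σ)))
    }
    where
    values : List ℕ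
    values = deduplicate ℕ._≟_ (map t (permutations n))
    value-attained : ∀ {k} → k ∈ˡ values → Attained t k
    value-attained k∈ with (σ , _ , k≡tσ) ← ∈-map⁻ t (∈-deduplicate⁻ ℕ._≟_ (map t (permutations n)) k∈) =
      σ , sym k≡tσ
    value∈ : ∀ σ → t σ ∈ˡ values
    value∈ σ = ∈-deduplicate⁺ ℕ._≟_
      (Any.map⁺ (Any.map (λ {τ} σ≈τ → t-cong {σ} {τ} σ≈τ) (permutations-complete n σ)))

-- The turning algebra

OppositeSteps-resp : ∀ {x y : Fin (suc (suc m)) → Fin n} → x ≗ y →
                     ∀ {j} → OppositeSteps x j → OppositeSteps y j
OppositeSteps-resp {x = x} {y} x≗y {j} = subst₂ OppositeSigns
  (cong₂ difference (x≗y (inject₁ (suc j))) (x≗y (inject₁ (inject₁ j))))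
  (cong₂ difference (x≗y (suc (suc j))) (x≗y (inject₁ (suc j))))
  where
  difference : Fin _ → Fin _ → ℤ.ℤ
  difference i k = ℤ.+ toℕ i ℤ.- ℤ.+ toℕ k

reducedTurningNumber-cong : ∀ {σ τ : Permutation′ n} → σ Perm.≈ τ →
                            reducedTurningNumber σ ≡ reducedTurningNumber τ
reducedTurningNumber-cong {zero}        σ≈τ = refl
reducedTurningNumber-cong {suc zero}    σ≈τ = refl
reducedTurningNumber-cong {suc (suc m)} {σ} {τ} σ≈τ = cong length
  (filter-≐ (oppositeSteps? (σ ⟨$⟩ʳ_)) (oppositeSteps? (τ ⟨$⟩ʳ_))
    (OppositeSteps-resp σ≈τ , OppositeSteps-resp (sym ∘ σ≈τ)) (allFin m))

reducedTurningNumber≤n : ∀ (σ : Permutation′ n) → reducedTurningNumber σ ℕ.≤ n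
reducedTurningNumber≤n {zero}        σ = z≤n
reducedTurningNumber≤n {suc zero}    σ = z≤n
reducedTurningNumber≤n {suc (suc m)} σ = ℕ.≤-trans
  (length-filter (oppositeSteps? (σ ⟨$⟩ʳ_)) (allFin m))
  (ℕ.≤-trans (ℕ.≤-reflexive (length-tabulate {n = m} id)) (ℕ.m≤n+m m 2))

-- Ruffles span the functions of the reduced turning number

data RuffleSpan {n} (a : ℚ[S n ]) : Set where
  zero : a ≈ 0# → RuffleSpan a
  term : ∀ q r {b} → a ≈ q • ruffle (suc r) n + b → RuffleSpan b → RuffleSpan a

module _ (n : ℕ) where

  private
    t : Permutation′ (suc n) → ℕ
    t = reducedTurningNumber

    R : ℕ → ℚ[S suc n ]
    R r = ruffle (suc r) (suc n)

  -- R m vanishes where t exceeds m but not where t equals m, so subtracting a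
  -- multiple of it lowers the bound on the support.
  span-below : ∀ m (f : ℕ → ℚ) → (∀ k → m ℕ.≤ k → f k ≡ 0ℚ) →
               ∀ a → (∀ σ → coeff a σ ≡ f (t σ)) → RuffleSpan a
  span-below zero    f f≡0 a a≡f = zero λ σ → trans (a≡f σ) (f≡0 (t σ) z≤n)
  span-below (suc m) f f≡0 a a≡f = term q m
    (λ σ → sym (restore q (coeff (R m) σ) (coeff a σ)))
    (span-below m f′ f′≡0 (a + (ℚ.- q) • R m)
      (λ σ → cong₂ (λ y z → y ℚ.+ (ℚ.- q) ℚ.* z) (a≡f σ) (ruffle-coeff n m σ)))
    where
    open +-*-Solver
    c : ℚ
    c = ruffleCoeff n m m
    instance
      c≢0 : ℚ.NonZero c
      c≢0 = ℚ.pos⇒nonZero c {{ruffleCoeff-lead n m}}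
    q : ℚ
    q = f m ℚ.* ℚ.1/ c
    f′ : ℕ → ℚ
    f′ k = f k ℚ.+ (ℚ.- q) ℚ.* ruffleCoeff n m k
    restore : ∀ q r a → q ℚ.* r ℚ.+ (a ℚ.+ (ℚ.- q) ℚ.* r) ≡ a
    restore = solve 3 (λ q r a → q :* r :+ (a :+ (:- q) :* r) := a) refl
    regroup : ∀ x i c → x ℚ.+ (ℚ.- (x ℚ.* i)) ℚ.* c ≡ x ℚ.+ (ℚ.- (x ℚ.* (i ℚ.* c)))
    regroup = solve 3 (λ x i c → x :+ (:- (x :* i)) :* c := x :+ (:- (x :* (i :* c)))) refl
    f′m≡0 : f′ m ≡ 0ℚ
    f′m≡0 = begin
      f m ℚ.+ (ℚ.- q) ℚ.* c                ≡⟨ regroup (f m) (ℚ.1/ c) c ⟩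
      f m ℚ.+ (ℚ.- (f m ℚ.* (ℚ.1/ c ℚ.* c))) ≡⟨ cong (λ z → f m ℚ.+ (ℚ.- (f m ℚ.* z))) (ℚ.*-inverseˡ c) ⟩
      f m ℚ.+ (ℚ.- (f m ℚ.* 1ℚ))           ≡⟨ cong (λ z → f m ℚ.+ (ℚ.- z)) (ℚ.*-identityʳ (f m)) ⟩
      f m ℚ.+ (ℚ.- f m)                    ≡⟨ ℚ.+-inverseʳ (f m) ⟩
      0ℚ                                   ∎
      where open ≡-Reasoning
    f′≡0 : ∀ k → m ℕ.≤ k → f′ k ≡ 0ℚ
    f′≡0 k m≤k with ℕ.m≤n⇒m<n∨m≡n m≤k
    ... | inj₁ m<k  = vanish-+ (f≡0 k m<k)
      (trans (cong ((ℚ.- q) ℚ.*_) (ruffleCoeff-low n m<k)) (ℚ.*-zeroʳ (ℚ.- q)))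
    ... | inj₂ refl = f′m≡0

  -- The elimination starts from a function that vanishes beyond some bound, so `f` is cut off above
  -- `suc n`, where no permutation takes its value.
  FunctionOf⇒span : ∀ {a} → a ∈ FunctionOf t → RuffleSpan a
  FunctionOf⇒span {a} (f , a≡f) = span-below (suc (suc n)) truncated truncated≡0 a
    (λ σ → trans (a≡f σ) (sym (trans
      (cong (ℚ._* f (t σ)) (𝟙-true (t σ ℕ.<? suc (suc n)) (s≤s (reducedTurningNumber≤n σ))))
      (ℚ.*-identityˡ (f (t σ))))))
    where
    truncated : ℕ → ℚ
    truncated k = 𝟙 (k ℕ.<? suc (suc n)) ℚ.* f k
    truncated≡0 : ∀ k → suc (suc n) ℕ.≤ k → truncated k ≡ 0ℚ
    truncated≡0 k n<k = trans
      (cong (ℚ._* f k) (𝟙-false (k ℕ.<? suc (suc n)) (ℕ.≤⇒≯ n<k))) (ℚ.*-zeroˡ (f k))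

  -- Closure and commutativity are carried together: commutativity transfers closure from `a * b` to
  -- `b * a`, so extending linearly in the right factor serves for both factors.
  record GoodPair (a b : ℚ[S suc n ]) : Set where
    constructor _,_
    field
      closed : a * b ∈ FunctionOf t
      comm   : a * b ≈ b * a

  good-sym : ∀ {a b} → GoodPair a b → GoodPair b a
  good-sym (closed , comm) = FunctionOf-resp comm closed , sym ∘ comm

  good-respʳ : ∀ {a b b′} → b′ ≈ b → GoodPair a b → GoodPair a b′
  good-respʳ {a} {b} {b′} b′≈b (closed , comm) =
    FunctionOf-resp (sym ∘ ab′≈ab) closed ,
    λ π → trans (ab′≈ab π) (trans (comm π) (sym (*-cong {x = b′} {b} {a} {a} b′≈b (λ _ → refl) π)))
    where
    ab′≈ab : a * b′ ≈ a * b
    ab′≈ab = *-cong {x = a} {a} {b′} {b} (λ _ → refl) b′≈b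

  good-0 : ∀ a → GoodPair a 0#
  good-0 a = FunctionOf-resp (sym ∘ *-zeroʳ a)
               (FunctionOf-0) ,
             λ π → trans (*-zeroʳ a π) (sym (*-zeroˡ a π))

  good-linear : ∀ {a b c} q → GoodPair a b → GoodPair a c → GoodPair a (q • b + c)
  good-linear {a} {b} {c} q (ab-closed , ab≈ba) (ac-closed , ac≈ca) =
    FunctionOf-resp (sym ∘ expandˡ)
      (FunctionOf-+
        (FunctionOf-• q ab-closed) ac-closed) ,
    λ π → trans (expandˡ π)
      (trans (cong₂ (λ y z → q ℚ.* y ℚ.+ z) (ab≈ba π) (ac≈ca π)) (sym (expandʳ π)))
    where
    expandˡ : a * (q • b + c) ≈ q • (a * b) + a * c
    expandˡ π = trans (*-distribˡ-+ a (q • b) c π) (cong (ℚ._+ coeff (a * c) π) (*-•-comm q a b π))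
    expandʳ : (q • b + c) * a ≈ q • (b * a) + c * a
    expandʳ π = trans (*-distribʳ-+ (q • b) c a π) (cong (ℚ._+ coeff (c * a) π) (•-*-assoc q b a π))

  good-ruffles : ∀ r s → GoodPair (R r) (R s)
  good-ruffles r s =
    FunctionOf-resp (sym ∘ ruffle-* (suc r) (suc s) (suc n))
      (FunctionOf-+ R-product R-product) ,
    λ π → trans (ruffle-* (suc r) (suc s) (suc n) π)
      (trans (cong (λ a → coeff (ruffle a (suc n) + ruffle a (suc n)) π) (ℕ.*-comm (suc r) (suc s)))
             (sym (ruffle-* (suc s) (suc r) (suc n) π)))
    where
    R-product : ruffle (suc r ℕ.* suc s) (suc n) ∈ FunctionOf t
    -- `suc r ℕ.* suc s` computes to `suc (s ℕ.+ r ℕ.* suc s)`, and `ruffleCoeff` takes the number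
    -- of letters less one.
    R-product = ruffleCoeff n (s ℕ.+ r ℕ.* suc s) , ruffle-coeff n (s ℕ.+ r ℕ.* suc s)

  good-span : ∀ {a b} → (∀ r → GoodPair a (R r)) → RuffleSpan b → GoodPair a b
  good-span {a} good (zero b≈0)            = good-respʳ b≈0 (good-0 a)
  good-span {a} good (term q r b≈ b′-span) =
    good-respʳ b≈ (good-linear q (good r) (good-span good b′-span))

  good : ∀ {a b} → a ∈ FunctionOf t → b ∈ FunctionOf t → GoodPair a b
  good a∈ b∈ = good-span
    -- Extend from ruffles to `a` on the right of a ruffle, exchange the factors, then extend to
    -- `b`.
    (λ r → good-sym (good-span (good-ruffles r) (FunctionOf⇒span a∈))) (FunctionOf⇒span b∈)

mainTheorem4 : ∀ (n : ℕ) → n ≥ 1 →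
    ∃ λ (A : Pred ℚ[S n ] 0ℓ) →
    IsSubalgebra A
    × IsBasis A (Attained (reducedTurningNumber {n})) (classSum (reducedTurningNumber {n}))
    × Commutative A
mainTheorem4 (suc n) _ =
  FunctionOf reducedTurningNumber ,
  record
    { resp-≈   = FunctionOf-resp
    ; 0-closed = FunctionOf-0
    ; +-closed = FunctionOf-+
    ; •-closed = FunctionOf-•
    ; *-closed = λ a∈ b∈ → GoodPair.closed (good n a∈ b∈)
    } ,
  classSum-basis reducedTurningNumber reducedTurningNumber-cong ,
  λ a∈ b∈ → GoodPair.comm (good n a∈ b∈)
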